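{- Let $q\ge 2$ and $n\ge 1$ be integers. The number $B_n(q)$ of symmetric $q$-ary $n\times n$ matrices that are (strong) lonesum matrices equals $$1+\sum_{j=1}^{n}\ \sum_{(n_0,n_1,\ldots,n_j)\in\mathcal{S}_n^j}\binom{n}{n_0,n_1,\ldots,n_j}\Bigg(\prod_{i=1}^{\lfloor j/2\rfloor} f_q(n_{2i-1},n_{2i})\Bigg)\Bigg(1+(q-2)\Big(n-\sum_{i=0}^{2\lfloor j/2\rfloor} n_i\Big)\Bigg),$$ where $f_q(r,s)=1+(q-2)rs+r\big((q-1)^s-(q-2)s-1\big)+s\big((q-1)^r-(q-2)r-1\big)$.
   Context: A $q$-ary matrix has entries in $\{0,1,\ldots,q-1\}$. A $q$-ary $n\times n$ matrix $M$ is a (strong) lonesum matrix if it is the only $q$-ary $n\times n$ matrix with the same row sums and the same column sums as $M$. For integers $j\ge 1$, $l\ge 1$, $\mathcal{S}_l^j=\{(l_0,l_1,\ldots,l_j)\in\mathbb{Z}^{j+1} : \sum_{i=0}^j l_i=l,\ l_0\ge 0,\ l_i\ge 1 \text{ for } 1\le i\le j\}$. $\binom{n}{n_0,\ldots,n_j}$ denotes the multinomial coefficient; an empty product equals $1$. -}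

module Defs where

open import Data.Nat as ℕ using (ℕ; zero; suc; _≤_; _≤?_; _≟_)
open import Data.Nat.DivMod using (_/_)
open import Data.Nat.Combinatorics using (_C_)
open import Data.Nat.ListAction using (sum)
open import Data.Integer as ℤ using (ℤ; +_)
open import Data.Fin using (Fin; toℕ)
open import Data.Vec as Vec using (Vec; transpose; lookup)
open import Data.List as List using (List; []; _∷_; length; upTo; filter; drop; take)
open import Data.List.Relation.Unary.All using (All; all?)
open import Data.List.Relation.Unary.Unique.Propositional using (Unique)
open import Data.List.Membership.Propositional using (_∈_)
open import Data.Product using (Σ; _×_)
open import Function.Bundles using (_⇔_)
open import Relation.Binary.PropositionalEquality using (_≡_)
open import Relation.Nullary.Decidable using (_×-dec_)

Matrix : ℕ → ℕ → Set
Matrix q n = Vec (Vec (Fin q) n) n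

entry : ∀ {q n} → Matrix q n → Fin n → Fin n → Fin q
entry M i j = lookup (lookup M i) j

rowSums : ∀ {q n} → Matrix q n → Vec ℕ n
rowSums M = Vec.map (λ r → Vec.sum (Vec.map toℕ r)) M

colSums : ∀ {q n} → Matrix q n → Vec ℕ n
colSums M = rowSums (transpose M)

IsSymmetric : ∀ {q n} → Matrix q n → Set
IsSymmetric M = ∀ i j → entry M i j ≡ entry M j i

IsLonesum : ∀ {q n} → Matrix q n → Set
IsLonesum {q} {n} M =
  (M' : Matrix q n) → rowSums M' ≡ rowSums M → colSums M' ≡ colSums M → M' ≡ M

CountIs : {A : Set} → (A → Set) → ℕ → Set
CountIs {A} P k =
  Σ (List A) λ L → Unique L × ((x : A) → (x ∈ L) ⇔ P x) × length L ≡ k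

sumℤ : List ℤ → ℤ
sumℤ = List.foldr ℤ._+_ (+ 0)

prodℤ : List ℤ → ℤ
prodℤ = List.foldr ℤ._*_ (+ 1)

-- the i-th entry (0-based) of a tuple (0 outside the range; never used there)
at : List ℕ → ℕ → ℕ
at []       _       = 0
at (x ∷ xs) zero    = x
at (x ∷ xs) (suc i) = at xs i

tuples : ℕ → ℕ → List (List ℕ)
tuples zero    l = [] ∷ []
tuples (suc k) l =
  List.concatMap (λ x → List.map (x ∷_) (tuples k l)) (upTo (suc l))

S : ℕ → ℕ → List (List ℕ)
S l j = filter (λ xs → (sum xs ≟ l) ×-dec all? (1 ≤?_) (drop 1 xs))
               (tuples (suc j) l)

multinomial : List ℕ → ℕ
multinomial []       = 1
multinomial (k ∷ ks) = ((k ℕ.+ sum ks) C k) ℕ.* multinomial ks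

f : ℕ → ℕ → ℕ → ℤ
f q r s =
  + 1 ℤ.+ q-2 ℤ.* R ℤ.* Sz
    ℤ.+ R  ℤ.* (q-1 ℤ.^ s ℤ.- q-2 ℤ.* Sz ℤ.- + 1)
    ℤ.+ Sz ℤ.* (q-1 ℤ.^ r ℤ.- q-2 ℤ.* R ℤ.- + 1)
  where
  q-2 = + q ℤ.- + 2
  q-1 = + q ℤ.- + 1
  R   = + r
  Sz  = + s

term : ℕ → ℕ → ℕ → List ℕ → ℤ
term q n j ns =
  + multinomial ns
  ℤ.* prodℤ (List.map (λ i → f q (at ns (2 ℕ.* i ℕ.∸ 1)) (at ns (2 ℕ.* i)))
                      (List.map suc (upTo (j / 2))))
  ℤ.* (+ 1 ℤ.+ (+ q ℤ.- + 2)
               ℤ.* (+ n ℤ.- + sum (take (suc (2 ℕ.* (j / 2))) ns)))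

formula : ℕ → ℕ → ℤ
formula q n =
  + 1 ℤ.+ sumℤ (List.map (λ j → sumℤ (List.map (term q n j) (S n j)))
                         (List.map suc (upTo n)))

{-# OPTIONS --safe #-}
module Submission where

-- Write entries as 0 (O), q - 1 (T) or something in between (mid). A matrix is
-- lonesum iff it has no switch: positive entries at (i , j), (i′ , j′) and
-- entries below q - 1 at (i , j′), (i′ , j), with i ≠ i′ and j ≠ j′. If a
-- switch-free matrix has the same sums as another one, then starting from a row
-- where the other matrix has a larger entry one can walk to such rows of ever
-- larger total rank (0, 1, 2 for O, mid, T), which is impossible.
--
-- In a symmetric switch-free matrix the supports of the rows form a chain.
-- Split off the n₀ zero rows. If the remaining matrix has no zero entry, it is
-- constant T up to a single diagonal mid. Otherwise its r full rows and the s
-- rows supported exactly on the full ones are nonempty classes; the entries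
-- among the full rows and between them and the rest are T, except that the
-- r × s corner may have mid entries, all in one row or all in one column.
-- Deleting both classes leaves a matrix of the same kind,
-- so iterating gives the pairs (r , s) = (n₂ᵢ₋₁ , n₂ᵢ) of the formula.

open import Defs
open import Algebra.Properties.CommutativeSemigroup using (interchange)
open import Data.Bool using (if_then_else_; true; false)
open import Data.Empty using (⊥; ⊥-elim)
open import Data.Fin as Fin using (Fin; zero; suc; toℕ; fromℕ; inject₁)
import Data.Fin.Properties as Finₚ
open import Data.Fin.Relation.Unary.Top using (view; ‵fromℕ; ‵inject₁)
open import Data.Integer as ℤ using (ℤ; +_)
import Data.Integer.Properties as ℤₚ
open import Data.Integer.Tactic.RingSolver using (solve-∀)
open import Data.List as List using (List; []; _∷_; _++_; length; map; upTo; applyUpTo; allFin; filter; take; concatMap)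
import Data.List.Properties as Listₚ
open import Data.List.Membership.Propositional using (_∈_)
open import Data.List.Membership.Propositional.Properties using (∈-map⁺; ∈-map⁻; ∈-++⁺ˡ; ∈-++⁺ʳ; ∈-++⁻; ∈-allFin; ∈-upTo⁺)
open import Data.List.Relation.Unary.All as All using (All; []; _∷_; all?)
import Data.List.Relation.Unary.All.Properties as Allₚ
open import Data.List.Relation.Unary.AllPairs using ([]; _∷_)
open import Data.List.Relation.Unary.Any using (here; there)
open import Data.List.Relation.Unary.Unique.Propositional using (Unique)
import Data.List.Relation.Unary.Unique.Propositional.Properties as Uniqueₚ
open import Data.Maybe using (Maybe; just; nothing)
open import Data.Nat as ℕ using (ℕ; zero; suc; pred; _≤_; _<_; z≤n; s≤s; _+_; _*_; _∸_; _^_)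
open import Data.Nat.Combinatorics using (_C_; nCk+nC[k+1]≡[n+1]C[k+1]; k>n⇒nCk≡0; nCn≡1)
open import Data.Nat.DivMod using (_/_; m/n≡1+[m∸n]/n)
open import Data.Nat.ListAction using (sum)
import Data.Nat.Properties as ℕₚ
open import Data.Nat.Tactic.RingSolver using () renaming (solve-∀ to solveℕ-∀)
open import Data.Product using (Σ; ∃; ∃₂; _×_; _,_; proj₁; proj₂)
open import Data.Sum as Sum using (_⊎_; inj₁; inj₂; [_,_])
import Data.Sum.Properties as Sumₚ
open import Data.Unit using (⊤; tt)
open import Data.Vec as Vec using (Vec; []; _∷_; lookup; tabulate)
import Data.Vec.Properties as Vecₚ
open import Function using (_∘_; id)
open import Function.Bundles using (mk⇔; module Equivalence)
open import Relation.Binary.PropositionalEquality hiding ([_])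
open import Relation.Nullary using (¬_; Dec; yes; no; does)
open import Relation.Nullary.Decidable using (_×-dec_; ¬?; decidable-stable)

open Equivalence using (to; from)

-- Two things about an entry matter: whether it can be lowered (`Pos`) and whether it can be raised
-- (`Low`); a switch is a rectangle around which one unit can be moved. The competitors in the
-- definition of a lonesum matrix need not be symmetric, so both directions of the switch criterion
-- are proved for arbitrary matrices, and symmetry serves only the block structure.
--
-- With `p = q - 2` mid values, a corner has no mid entry in 1 way, exactly one in `p * r * s` ways,
-- and otherwise at least two in a single row or column; these add up to `f q r s`. The classes can
-- be read off from the matrix, as its full rows and then the zero rows of what is left, so every
-- matrix is counted once. The final positive block of size m contributes `1 + m * p`: for m > 0 it
-- is the unpaired last class of an odd j, and for m = 0 it is the factor 1 of an even j.
--
-- All counting is done in ℕ by recursions without subtraction; the differences in the formula enter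
-- only when the counts are compared with it in ℤ.

private variable
  A B : Set

-- Counting

unique-map : (h : A → B) (xs : List A) →
  (∀ {x y} → x ∈ xs → y ∈ xs → h x ≡ h y → x ≡ y) → Unique xs → Unique (map h xs)
unique-map h []       inj []       = []
unique-map h (x ∷ xs) inj (x∉ ∷ u) =
  Allₚ.map⁺ (All.tabulate λ y∈ eq → All.lookup x∉ y∈ (inj (here refl) (there y∈) eq))
  ∷ unique-map h xs (λ x∈ y∈ → inj (there x∈) (there y∈)) u

-- Injectivity is asked on `P` only, because the constructions below lose information on degenerate
-- data: an empty row, say, can be placed anywhere in a table with the same result.
count-image : {P : A → Set} {Q : B → Set} {k : ℕ} (h : A → B) → CountIs P k →
  (∀ {x y} → P x → P y → h x ≡ h y → x ≡ y) →
  (∀ {x} → P x → Q (h x)) →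
  (∀ {y} → Q y → ∃ λ x → P x × h x ≡ y) → CountIs Q k
count-image {P = P} {Q} h (L , u , mem , len) inj sound complete =
  map h L ,
  unique-map h L (λ x∈ y∈ → inj (to (mem _) x∈) (to (mem _) y∈)) u ,
  (λ y → mk⇔ (fwd y) (bwd y)) ,
  trans (Listₚ.length-map h L) len
  where
  fwd : ∀ y → y ∈ map h L → Q y
  fwd y y∈ with x , x∈ , refl ← ∈-map⁻ h y∈ = sound (to (mem x) x∈)
  bwd : ∀ y → Q y → y ∈ map h L
  bwd y q with x , p , refl ← complete q = ∈-map⁺ h (from (mem x) p)

count-cong : {P Q : A → Set} {k : ℕ} → (∀ x → P x → Q x) → (∀ x → Q x → P x) →
  CountIs P k → CountIs Q k
count-cong pq qp (L , u , mem , len) =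
  L , u , (λ x → mk⇔ (pq x ∘ to (mem x)) (from (mem x) ∘ qp x)) , len

count-⊎ : {P Q : A → Set} {k l : ℕ} → CountIs P k → CountIs Q l →
  (∀ x → P x → Q x → ⊥) → CountIs (λ x → P x ⊎ Q x) (k + l)
count-⊎ (L , u , mem , len) (L' , u' , mem' , len') disj =
  L ++ L' ,
  Uniqueₚ.++⁺ u u' (λ (v∈ , v∈') → disj _ (to (mem _) v∈) (to (mem' _) v∈')) ,
  (λ x → mk⇔ (Sum.map (to (mem x)) (to (mem' x)) ∘ ∈-++⁻ L)
             [ ∈-++⁺ˡ ∘ from (mem x) , ∈-++⁺ʳ L ∘ from (mem' x) ]) ,
  trans (Listₚ.length-++ L) (cong₂ _+_ len len')

count-∅ : {P : A → Set} → (∀ x → ¬ P x) → CountIs P 0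
count-∅ ¬p = [] , [] , (λ x → mk⇔ (λ ()) (⊥-elim ∘ ¬p x)) , refl

count-≡ : (a : A) → CountIs (_≡ a) 1
count-≡ a = a ∷ [] , [] ∷ [] , (λ x → mk⇔ (λ { (here eq) → eq ; (there ()) }) here) , refl

count-Fin : ∀ p → CountIs {Fin p} (λ _ → ⊤) p
count-Fin p = allFin p , Uniqueₚ.allFin⁺ p , (λ x → mk⇔ (λ _ → tt) (λ _ → ∈-allFin x)) ,
    Listₚ.length-tabulate id

count-Σ : {B : A → Set} {Q : ∀ a → B a → Set} (I : List A) → Unique I → (c : A → ℕ) →
  (∀ a → a ∈ I → CountIs (Q a) (c a)) →
  CountIs {Σ A B} (λ (a , b) → a ∈ I × Q a b) (sum (map c I))
count-Σ []      _        c count = count-∅ λ { _ (() , _) }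
count-Σ {A = A} {B} {Q} (a ∷ I) (a∉ ∷ u) c count =
  count-cong join split
    (count-⊎ first (count-Σ I u c (λ a' → count a' ∘ there)) disjoint)
  where
  First : Σ A B → Set
  First (a' , b) = Σ (a' ≡ a) λ { refl → Q a b }
  first : CountIs First (c a)
  first = count-image (a ,_) (count a (here refl)) (λ { _ _ refl → refl }) (refl ,_)
    (λ { {_ , b} (refl , q) → b , q , refl })
  disjoint : ∀ x → First x → proj₁ x ∈ I × Q (proj₁ x) (proj₂ x) → ⊥
  disjoint _ (refl , _) (a∈ , _) = All.lookup a∉ a∈ refl
  join : ∀ x → First x ⊎ (proj₁ x ∈ I × Q (proj₁ x) (proj₂ x)) → proj₁ x ∈ (a ∷ I) × Q (proj₁ x) (proj₂ x)
  join _ (inj₁ (refl , q)) = here refl , q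
  join _ (inj₂ (a∈ , q))   = there a∈ , q
  split : ∀ x → proj₁ x ∈ (a ∷ I) × Q (proj₁ x) (proj₂ x) → First x ⊎ (proj₁ x ∈ I × Q (proj₁ x) (proj₂ x))
  split _ (here refl , q) = inj₁ (refl , q)
  split _ (there a∈ , q)  = inj₂ (a∈ , q)

count-× : {P : A → Set} {Q : B → Set} {k l : ℕ} → CountIs P k → CountIs Q l →
  CountIs {A × B} (λ (a , b) → P a × Q b) (k * l)
count-× {Q = Q} {l = l} (L , u , mem , refl) count =
  subst (CountIs _) (sum-const L)
    (count-cong (λ (a , _) (a∈ , q) → to (mem a) a∈ , q) (λ (a , _) (p , q) → from (mem a) p , q)
      (count-Σ L u (λ _ → l) (λ _ _ → count)))
  where
  sum-const : ∀ {C : Set} (xs : List C) → sum (map (λ _ → l) xs) ≡ length xs * l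
  sum-const []       = refl
  sum-const (x ∷ xs) = cong (λ k → l + k) (sum-const xs)

-- Corner blocks

Table : Set → ℕ → ℕ → Set
Table A m n = Vec (Vec A n) m

infix 9 _⟨_,_⟩
_⟨_,_⟩ : ∀ {m n} → Table A m n → Fin m → Fin n → A
M ⟨ i , j ⟩ = lookup (lookup M i) j

table : ∀ {m n} → (Fin m → Fin n → A) → Table A m n
table g = tabulate λ i → tabulate (g i)

at-table : ∀ {m n} (g : Fin m → Fin n → A) i j → table g ⟨ i , j ⟩ ≡ g i j
at-table g i j = trans (cong (λ v → lookup v j) (Vecₚ.lookup∘tabulate _ i)) (Vecₚ.lookup∘tabulate _ j)

vec-ext : ∀ {n} {u v : Vec A n} → (∀ i → lookup u i ≡ lookup v i) → u ≡ v
vec-ext {u = u} {v} eq =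
  trans (sym (Vecₚ.tabulate∘lookup u)) (trans (Vecₚ.tabulate-cong eq) (Vecₚ.tabulate∘lookup v))

table-ext : ∀ {m n} {M N : Table A m n} → (∀ i j → M ⟨ i , j ⟩ ≡ N ⟨ i , j ⟩) → M ≡ N
table-ext eq = vec-ext λ i → vec-ext (eq i)

pred≤⇒≤suc : ∀ t {m} → pred t ≤ m → t ≤ suc m
pred≤⇒≤suc zero    _ = z≤n
pred≤⇒≤suc (suc _) w = s≤s w

module _ {p : ℕ} where

  private
    Cell : Set
    Cell = Maybe (Fin p)

  Marked : Cell → Set
  Marked x = x ≢ nothing

  marked? : (x : Cell) → Dec (Marked x)
  marked? nothing  = no λ m → m refl
  marked? (just x) = yes λ ()

  unmarked : {x : Cell} → ¬ Marked x → x ≡ nothing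
  unmarked {nothing} _ = refl
  unmarked {just x}  u = ⊥-elim (u λ ())

  weight : ∀ {n} → Vec Cell n → ℕ
  weight []             = 0
  weight (nothing ∷ v) = weight v
  weight (just _ ∷ v)  = suc (weight v)

  weight≥1⇒marked : ∀ {n} (v : Vec Cell n) → 1 ≤ weight v → ∃ λ i → Marked (lookup v i)
  weight≥1⇒marked (just _ ∷ v)  _ = zero , λ ()
  weight≥1⇒marked (nothing ∷ v) w = let i , m = weight≥1⇒marked v w in suc i , m

  marked⇒weight≥1 : ∀ {n} (v : Vec Cell n) i → Marked (lookup v i) → 1 ≤ weight v
  marked⇒weight≥1 (just _ ∷ v)  i       m = s≤s z≤n
  marked⇒weight≥1 (nothing ∷ v) zero    m = ⊥-elim (m refl)
  marked⇒weight≥1 (nothing ∷ v) (suc i) m = marked⇒weight≥1 v i m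

  weight≥2⇒marked : ∀ {n} (v : Vec Cell n) → 2 ≤ weight v →
    ∃₂ λ i j → i ≢ j × Marked (lookup v i) × Marked (lookup v j)
  weight≥2⇒marked (just _ ∷ v)  (s≤s w) =
    let j , m = weight≥1⇒marked v w in zero , suc j , (λ ()) , (λ ()) , m
  weight≥2⇒marked (nothing ∷ v) w =
    let i , j , i≢j , mi , mj = weight≥2⇒marked v w in suc i , suc j , i≢j ∘ Finₚ.suc-injective , mi , mj

  marked⇒weight≥2 : ∀ {n} (v : Vec Cell n) i j → i ≢ j → Marked (lookup v i) → Marked (lookup v j) →
      2 ≤ weight v
  marked⇒weight≥2 v             zero    zero    i≢j _  _  = ⊥-elim (i≢j refl)
  marked⇒weight≥2 (just _ ∷ v)  zero    (suc j) _   _  mj = s≤s (marked⇒weight≥1 v j mj)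
  marked⇒weight≥2 (just _ ∷ v)  (suc i) _       _   mi _  = s≤s (marked⇒weight≥1 v i mi)
  marked⇒weight≥2 (nothing ∷ v) zero    _       _   mi _  = ⊥-elim (mi refl)
  marked⇒weight≥2 (nothing ∷ v) (suc _) zero    _   _  mj = ⊥-elim (mj refl)
  marked⇒weight≥2 (nothing ∷ v) (suc i) (suc j) i≢j mi mj = marked⇒weight≥2 v i j (i≢j ∘ cong suc) mi mj

  -- The number of vectors of length n with at least t marked cells, by cases on the first cell.
  -- `0 ^ t` is 1 for t = 0 only, and `pred` keeps a threshold at 0 once it is met.
  heavy : ℕ → ℕ → ℕ
  heavy t zero    = 0 ^ t
  heavy t (suc n) = heavy t n + p * heavy (pred t) n

  count-heavy : ∀ t n → CountIs {Vec Cell n} (λ v → t ≤ weight v) (heavy t n)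
  count-heavy zero    zero    = count-cong (λ _ _ → z≤n) (λ { [] _ → refl }) (count-≡ [])
  count-heavy (suc t) zero    = count-∅ λ { [] () }
  count-heavy t       (suc n) =
      count-cong join split (count-⊎ light dark (λ { _ (_ , _ , refl) (_ , _ , _ , ()) }))
    where
    Light Dark : Vec Cell (suc n) → Set
    Light v = ∃ λ u → t ≤ weight u × v ≡ nothing ∷ u
    Dark v = ∃₂ λ d u → pred t ≤ weight u × v ≡ just d ∷ u
    light : CountIs Light (heavy t n)
    light = count-image (nothing ∷_) (count-heavy t n) (λ { _ _ refl → refl }) (λ {u} w → u , w , refl)
      (λ { (u , w , refl) → u , w , refl })
    dark : CountIs Dark (p * heavy (pred t) n)
    dark = count-image (λ (d , u) → just d ∷ u) (count-× (count-Fin p) (count-heavy (pred t) n))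
      (λ { _ _ refl → refl }) (λ { {d , u} (_ , w) → d , u , w , refl })
      (λ { (d , u , w , refl) → (d , u) , (tt , w) , refl })
    join : ∀ v → Light v ⊎ Dark v → t ≤ weight v
    join _ (inj₁ (u , w , refl))     = w
    join _ (inj₂ (d , u , w , refl)) = pred≤⇒≤suc t w
    split : ∀ v → t ≤ weight v → Light v ⊎ Dark v
    split (nothing ∷ u) w = inj₁ (u , w , refl)
    split (just d ∷ u)  w = inj₂ (d , u , ℕₚ.pred-mono-≤ w , refl)

  -- The pairwise condition is what the absence of switches yields directly. It already puts all
  -- marks on one line: a mark off the row of two others would have to lie in both of their columns.
  Collinear : ∀ {r s} → Table Cell r s → Set
  Collinear F = ∀ i i' j j' → Marked (F ⟨ i , j ⟩) → Marked (F ⟨ i' , j' ⟩) → i ≡ i' ⊎ j ≡ j'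

  -- No mark, a row with at least one, a column with at least two. The different thresholds keep the
  -- cases disjoint: a single mark counts as a row.
  collinear : ℕ → ℕ → ℕ
  collinear r s = 1 + (r * heavy 1 s + s * heavy 2 r)

  column : ∀ {r s} → Table Cell r s → Fin s → Vec Cell r
  column F j = tabulate λ i → F ⟨ i , j ⟩

  rowOnly : ∀ {r s} → Fin r → Vec Cell s → Fin r → Fin s → Cell
  rowOnly i v i' j with i' Fin.≟ i
  ... | yes _ = lookup v j
  ... | no  _ = nothing

  colOnly : ∀ {r s} → Fin s → Vec Cell r → Fin r → Fin s → Cell
  colOnly j v i j' with j' Fin.≟ j
  ... | yes _ = lookup v i
  ... | no  _ = nothing

  rowOnly-≡ : ∀ {r s} (i : Fin r) (v : Vec Cell s) j → rowOnly i v i j ≡ lookup v j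
  rowOnly-≡ i v j with i Fin.≟ i
  ... | yes _  = refl
  ... | no i≢i = ⊥-elim (i≢i refl)

  colOnly-≡ : ∀ {r s} (j : Fin s) (v : Vec Cell r) i → colOnly j v i j ≡ lookup v i
  colOnly-≡ j v i with j Fin.≟ j
  ... | yes _  = refl
  ... | no j≢j = ⊥-elim (j≢j refl)

  rowOnly-marked : ∀ {r s} (i : Fin r) (v : Vec Cell s) {i' j} → Marked (rowOnly i v i' j) → i' ≡ i
  rowOnly-marked i v {i'} m with i' Fin.≟ i
  ... | yes eq = eq
  ... | no  _  = ⊥-elim (m refl)

  colOnly-marked : ∀ {r s} (j : Fin s) (v : Vec Cell r) {i j'} → Marked (colOnly j v i j') → j' ≡ j
  colOnly-marked j v {j' = j'} m with j' Fin.≟ j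
  ... | yes eq = eq
  ... | no  _  = ⊥-elim (m refl)

  module _ {r s : ℕ} where

    blank : Table Cell r s
    blank = table λ _ _ → nothing

    RowType ColType : Table Cell r s → Set
    RowType F = ∃₂ λ i v → 1 ≤ weight v × table (rowOnly i v) ≡ F
    ColType F = ∃₂ λ j v → 2 ≤ weight v × table (colOnly j v) ≡ F

    row-marked : ∀ i (v : Vec Cell s) {i' j} → Marked (table (rowOnly {r} i v) ⟨ i' , j ⟩) → i' ≡ i
    row-marked i v {i'} {j} m = rowOnly-marked i v {i'} {j} (subst Marked (at-table (rowOnly i v) i' j) m)

    col-marked : ∀ j (v : Vec Cell r) {i j'} → Marked (table (colOnly {s = s} j v) ⟨ i , j' ⟩) → j' ≡ j
    col-marked j v {i} {j'} m = colOnly-marked j v {i} (subst Marked (at-table (colOnly j v) i j') m)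

    at-row : ∀ i (v : Vec Cell s) j → table (rowOnly {r} i v) ⟨ i , j ⟩ ≡ lookup v j
    at-row i v j = trans (at-table _ i j) (rowOnly-≡ i v j)

    at-col : ∀ j (v : Vec Cell r) i → table (colOnly {s = s} j v) ⟨ i , j ⟩ ≡ lookup v i
    at-col j v i = trans (at-table _ i j) (colOnly-≡ j v i)

    count-row : CountIs RowType (r * heavy 1 s)
    count-row = count-image (λ (i , v) → table (rowOnly i v)) (count-× (count-Fin r) (count-heavy 1 s)) inj
      (λ { {i , v} (_ , w) → i , v , w , refl }) (λ { (i , v , w , refl) → (i , v) , (tt , w) , refl })
      where
      inj : ∀ {x y : Fin r × Vec Cell s} → _ → _ → table (rowOnly (proj₁ x) (proj₂ x)) ≡ table
          (rowOnly (proj₁ y) (proj₂ y)) → x ≡ y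
      inj {i , v} {i' , v'} (_ , w) _ eq
        with j , m ← weight≥1⇒marked v w
        with refl ← row-marked i' v' {i} {j}
            (subst (λ F → Marked (F ⟨ i , j ⟩)) eq (subst Marked (sym (at-row i v j)) m))
        = cong (i ,_) (vec-ext λ j → trans (sym (at-row i v j)) (trans (cong _⟨ i , j ⟩ eq) (at-row i v' j)))

    count-col : CountIs ColType (s * heavy 2 r)
    count-col = count-image (λ (j , v) → table (colOnly j v)) (count-× (count-Fin s) (count-heavy 2 r)) inj
      (λ { {j , v} (_ , w) → j , v , w , refl }) (λ { (j , v , w , refl) → (j , v) , (tt , w) , refl })
      where
      inj : ∀ {x y : Fin s × Vec Cell r} → _ → _ → table (colOnly (proj₁ x) (proj₂ x)) ≡ table
          (colOnly (proj₁ y) (proj₂ y)) → x ≡ y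
      inj {j , v} {j' , v'} (_ , w) _ eq
        with i , _ , _ , m , _ ← weight≥2⇒marked v w
        with refl ← col-marked j' v' {i} {j}
            (subst (λ F → Marked (F ⟨ i , j ⟩)) eq (subst Marked (sym (at-col j v i)) m))
        = cong (j ,_) (vec-ext λ i → trans (sym (at-col j v i)) (trans (cong _⟨ i , j ⟩ eq) (at-col j v' i)))

    count-collinear : CountIs {Table Cell r s} Collinear (collinear r s)
    count-collinear = count-cong join split
      (count-⊎ (count-≡ blank) (count-⊎ count-row count-col row≢col) blank≢)
      where
      unmarked-blank : ∀ {i j} → ¬ Marked (blank ⟨ i , j ⟩)
      unmarked-blank {i} {j} m = m (at-table (λ _ _ → nothing) i j)
      row≢col : ∀ F → RowType F → ColType F → ⊥
      row≢col _ (i , v , _ , refl) (j , u , w , eq)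
        with i₁ , i₂ , i₁≢i₂ , m₁ , m₂ ← weight≥2⇒marked u w =
        i₁≢i₂ (trans (here-row i₁ m₁) (sym (here-row i₂ m₂)))
        where
        here-row : ∀ i' → Marked (lookup u i') → i' ≡ i
        here-row i' m = row-marked i v
            (subst (λ F → Marked (F ⟨ i' , j ⟩)) eq (subst Marked (sym (at-col j u i')) m))
      blank≢ : ∀ F → F ≡ blank → RowType F ⊎ ColType F → ⊥
      blank≢ _ refl (inj₁ (i , v , w , eq)) with j , m ← weight≥1⇒marked v w =
        unmarked-blank (subst (λ F → Marked (F ⟨ i , j ⟩)) eq (subst Marked (sym (at-row i v j)) m))
      blank≢ _ refl (inj₂ (j , v , w , eq)) with i , _ , _ , m , _ ← weight≥2⇒marked v w =
        unmarked-blank (subst (λ F → Marked (F ⟨ i , j ⟩)) eq (subst Marked (sym (at-col j v i)) m))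
      join : ∀ F → F ≡ blank ⊎ RowType F ⊎ ColType F → Collinear F
      join _ (inj₁ refl) i i' j j' m _ = ⊥-elim (unmarked-blank m)
      join _ (inj₂ (inj₁ (i , v , _ , refl))) _ _ _ _ m m' =
          inj₁ (trans (row-marked i v m) (sym (row-marked i v m')))
      join _ (inj₂ (inj₂ (j , v , _ , refl))) _ _ _ _ m m' =
          inj₂ (trans (col-marked j v m) (sym (col-marked j v m')))
      split : ∀ F → Collinear F → F ≡ blank ⊎ RowType F ⊎ ColType F
      -- Columns with two marks come first: a mark off such a column would have to share the row of
      -- both. If there is none, all marks lie in the row of any one of them, since a mark in
      -- another row would have to share its column.
      split F coll with Finₚ.any? (λ j → 2 ℕ.≤? weight (column F j))
      split F coll | yes (j , w)
        with i₁ , i₂ , i₁≢i₂ , m₁ , m₂ ← weight≥2⇒marked (column F j) w =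
        inj₂ (inj₂ (j , column F j , w , table-ext λ i' j' → trans (at-table _ i' j') (eq i' j')))
        where
        at-column : ∀ {i} → Marked (lookup (column F j) i) → Marked (F ⟨ i , j ⟩)
        at-column {i} = subst Marked (Vecₚ.lookup∘tabulate _ i)
        outside : ∀ i' j' → j' ≢ j → ¬ Marked (F ⟨ i' , j' ⟩)
        outside i' j' j'≢j m with coll i' i₁ j' j m (at-column m₁) | coll i' i₂ j' j m (at-column m₂)
        ... | inj₂ e | _ = j'≢j e
        ... | _ | inj₂ e = j'≢j e
        ... | inj₁ e₁ | inj₁ e₂ = i₁≢i₂ (trans (sym e₁) e₂)
        eq : ∀ i' j' → colOnly j (column F j) i' j' ≡ F ⟨ i' , j' ⟩
        eq i' j' with j' Fin.≟ j
        ... | yes refl = Vecₚ.lookup∘tabulate _ i'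
        ... | no j'≢j  = sym (unmarked (outside i' j' j'≢j))
      split F coll | no light with Finₚ.any? (λ i → Finₚ.any? (λ j → marked? (F ⟨ i , j ⟩)))
      ... | no none = inj₁ (table-ext λ i j → trans (unmarked (λ m → none (i , j , m)))
          (sym (at-table _ i j)))
      ... | yes (i , j , m) =
        inj₂ (inj₁ (i , lookup F i , marked⇒weight≥1 (lookup F i) j m ,
          table-ext λ i' j' → trans (at-table _ i' j') (eq i' j')))
        where
        outside : ∀ i' j' → i' ≢ i → ¬ Marked (F ⟨ i' , j' ⟩)
        outside i' j' i'≢i m' with coll i' i j' j m' m
        ... | inj₁ e    = i'≢i e
        ... | inj₂ refl = light (j , marked⇒weight≥2 (column F j) i' i i'≢i
              (subst Marked (sym (Vecₚ.lookup∘tabulate _ i')) m')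
                  (subst Marked (sym (Vecₚ.lookup∘tabulate _ i)) m))
        eq : ∀ i' j' → rowOnly i (lookup F i) i' j' ≡ F ⟨ i' , j' ⟩
        eq i' j' with i' Fin.≟ i
        ... | yes refl = refl
        ... | no i'≢i  = sym (unmarked (outside i' j' i'≢i))

-- Splitting an index set in two

-- A subset with its size and that of its complement in the type. Both sides are numbered in
-- increasing order, so a principal submatrix is again indexed by a `Fin`.
data Split : ℕ → ℕ → ℕ → Set where
  []    : Split 0 0 0
  left  : ∀ {n a b} → Split n a b → Split (suc n) (suc a) b
  right : ∀ {n a b} → Split n a b → Split (suc n) a (suc b)

split-size : ∀ {n a b} → Split n a b → a + b ≡ n
split-size []        = refl
split-size (left σ)  = cong suc (split-size σ)
split-size (right σ) = trans (ℕₚ.+-suc _ _) (cong suc (split-size σ))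

side : ∀ {n a b} → Split n a b → Fin n → Fin a ⊎ Fin b
side (left σ)  zero    = inj₁ zero
side (left σ)  (suc i) = Sum.map₁ suc (side σ i)
side (right σ) zero    = inj₂ zero
side (right σ) (suc i) = Sum.map₂ suc (side σ i)

place : ∀ {n a b} → Split n a b → Fin a ⊎ Fin b → Fin n
place (left σ)  (inj₁ zero)    = zero
place (left σ)  (inj₁ (suc i)) = suc (place σ (inj₁ i))
place (left σ)  (inj₂ i)       = suc (place σ (inj₂ i))
place (right σ) (inj₁ i)       = suc (place σ (inj₁ i))
place (right σ) (inj₂ zero)    = zero
place (right σ) (inj₂ (suc i)) = suc (place σ (inj₂ i))

place-side : ∀ {n a b} (σ : Split n a b) i → place σ (side σ i) ≡ i
place-side (left σ)  zero    = refl
place-side (left σ)  (suc i) with side σ i | place-side σ i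
... | inj₁ _ | eq = cong suc eq
... | inj₂ _ | eq = cong suc eq
place-side (right σ) zero    = refl
place-side (right σ) (suc i) with side σ i | place-side σ i
... | inj₁ _ | eq = cong suc eq
... | inj₂ _ | eq = cong suc eq

side-place : ∀ {n a b} (σ : Split n a b) x → side σ (place σ x) ≡ x
side-place (left σ)  (inj₁ zero)    = refl
side-place (left σ)  (inj₁ (suc i)) rewrite side-place σ (inj₁ i) = refl
side-place (left σ)  (inj₂ i)       rewrite side-place σ (inj₂ i) = refl
side-place (right σ) (inj₁ i)       rewrite side-place σ (inj₁ i) = refl
side-place (right σ) (inj₂ zero)    = refl
side-place (right σ) (inj₂ (suc i)) rewrite side-place σ (inj₂ i) = refl

place-injective : ∀ {n a b} (σ : Split n a b) {x y} → place σ x ≡ place σ y → x ≡ y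
place-injective σ {x} {y} eq = trans (sym (side-place σ x)) (trans (cong (side σ) eq) (side-place σ y))

side-injective : ∀ {n a b} (σ : Split n a b) {i j} → side σ i ≡ side σ j → i ≡ j
side-injective σ {i} {j} eq = trans (sym (place-side σ i)) (trans (cong (place σ) eq) (place-side σ j))

classify : ∀ {n r m s k} → Split n r m → Split m s k → Fin n → Fin r ⊎ (Fin s ⊎ Fin k)
classify τ σ i = Sum.map₂ (side σ) (side τ i)

locate : ∀ {n r m s k} → Split n r m → Split m s k → Fin r ⊎ (Fin s ⊎ Fin k) → Fin n
locate τ σ x = place τ (Sum.map₂ (place σ) x)

locate-classify : ∀ {n r m s k} (τ : Split n r m) (σ : Split m s k) i → locate τ σ (classify τ σ i) ≡ i
locate-classify τ σ i = trans (cong (place τ) (undo (side τ i))) (place-side τ i)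
  where
  undo : ∀ x → Sum.map₂ (place σ) (Sum.map₂ (side σ) x) ≡ x
  undo (inj₁ _) = refl
  undo (inj₂ x) = cong inj₂ (place-side σ x)

classify-locate : ∀ {n r m s k} (τ : Split n r m) (σ : Split m s k) x → classify τ σ (locate τ σ x) ≡ x
classify-locate τ σ x = trans (cong (Sum.map₂ (side σ)) (side-place τ _)) (undo x)
  where
  undo : ∀ x → Sum.map₂ (side σ) (Sum.map₂ (place σ) x) ≡ x
  undo (inj₁ _) = refl
  undo (inj₂ x) = cong inj₂ (side-place σ x)

classify-injective : ∀ {n r m s k} (τ : Split n r m) (σ : Split m s k) {i j} →
    classify τ σ i ≡ classify τ σ j → i ≡ j
classify-injective τ σ {i} {j} eq =
  trans (sym (locate-classify τ σ i)) (trans (cong (locate τ σ) eq) (locate-classify τ σ j))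

Decides : ∀ {n a b} → Split n a b → (Fin n → Set) → Set
Decides σ D = (∀ i → D (place σ (inj₁ i))) × (∀ i → ¬ D (place σ (inj₂ i)))

Splitting : ℕ → (ℕ → ℕ → Set) → Set
Splitting n Y = Σ ℕ λ a → Σ ℕ λ b → Split n a b × Y a b

split-by : ∀ {n} {D : Fin n → Set} → (∀ i → Dec (D i)) → ∃₂ λ a b → Σ (Split n a b) λ σ → Decides σ D
split-by {zero}  D? = 0 , 0 , [] , (λ ()) , (λ ())
split-by {suc n} {D} D? with split-by (D? ∘ suc) | D? zero
... | a , b , σ , l , r | yes d = suc a , b , left σ , (λ { zero → d ; (suc i) → l i }) , r
... | a , b , σ , l , r | no ¬d = a , suc b , right σ , l , λ { zero → ¬d ; (suc i) → r i }

left-inhabited : ∀ {n a b} {D : Fin n → Set} (σ : Split n a b) → Decides σ D → ∃ D → 1 ≤ a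
left-inhabited {D = D} σ (_ , r) (i , d) with side σ i | place-side σ i
... | inj₁ zero    | _    = s≤s z≤n
... | inj₁ (suc _) | _    = s≤s z≤n
... | inj₂ x       | refl = ⊥-elim (r x d)

-- Equality of splits whose sizes are not yet known to agree; matching on `same` identifies sizes
-- and splits together.
data SameSplit {n : ℕ} : ∀ {a b a' b'} → Split n a b → Split n a' b' → Set where
  same : ∀ {a b} {σ : Split n a b} → SameSplit σ σ

-- This is how classes are recovered from a matrix: it is applied to the full rows and to the zero
-- rows.
split-unique : ∀ {n a b a' b'} (σ : Split n a b) (σ' : Split n a' b') (D : Fin n → Set) →
  Decides σ D → Decides σ' D → SameSplit σ σ'
split-unique []        []         D _ _ = same
split-unique (left σ)  (right σ') D (l , _) (_ , r) = ⊥-elim (r zero (l zero))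
split-unique (right σ) (left σ')  D (_ , r) (l , _) = ⊥-elim (r zero (l zero))
split-unique (left σ)  (left σ')  D (l , r) (l' , r')
  with split-unique σ σ' (D ∘ suc) (l ∘ suc , r) (l' ∘ suc , r')
... | same = same
split-unique (right σ) (right σ') D (l , r) (l' , r')
  with split-unique σ σ' (D ∘ suc) (l , r ∘ suc) (l' , r' ∘ suc)
... | same = same

-- Pascal's rule, by the side on which the first index falls.
count-split : ∀ n a b → a + b ≡ n → CountIs {Split n a b} (λ _ → ⊤) (n C a)
count-split zero zero zero refl = count-cong (λ _ _ → tt) (λ { [] _ → refl }) (count-≡ [])
count-split (suc n) zero (suc b) refl =
  count-image right (count-split n zero b refl) (λ { _ _ refl → refl }) (λ _ → tt)
      (λ { {right σ} _ → σ , tt , refl })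
count-split (suc n) (suc a) b eq =
  subst (CountIs _) (nCk+nC[k+1]≡[n+1]C[k+1] n a)
    (count-cong (λ _ _ → tt) (λ { (left σ) _ → inj₁ (σ , refl) ; (right σ) _ → inj₂ (_ , refl , σ , refl) })
      (count-⊎ lefts (rights b eq) λ { _ (_ , refl) (_ , refl , _ , ()) }))
  where
  lefts : CountIs (λ τ → ∃ λ σ → left σ ≡ τ) (n C a)
  lefts = count-image left (count-split n a b (ℕₚ.suc-injective eq)) (λ { _ _ refl → refl })
      (λ {σ} _ → σ , refl) (λ { (σ , eq) → σ , tt , eq })
  -- The constructor `right` exists only when b is a successor. For b = 0 the class is empty, in
  -- accordance with `n C suc a = 0`, since then a = n.
  Right : ∀ b → Split (suc n) (suc a) b → Set
  Right b τ = Σ ℕ λ b' → Σ (suc b' ≡ b) λ { refl → ∃ λ σ → right σ ≡ τ }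
  rights : ∀ b → suc a + b ≡ suc n → CountIs (Right b) (n C suc a)
  rights zero    eq = subst (CountIs _)
      (sym (k>n⇒nCk≡0 (ℕₚ.≤-reflexive (sym (trans (cong suc (sym (ℕₚ.+-identityʳ a))) eq)))))
        (count-∅ λ { _ (_ , () , _) })
  rights (suc b) eq = count-image right
      (count-split n (suc a) b (trans (sym (ℕₚ.+-suc a b)) (ℕₚ.suc-injective eq)))
    (λ { _ _ refl → refl }) (λ {σ} _ → b , refl , σ , refl) (λ { (_ , refl , σ , eq) → σ , tt , eq })

-- The range may exceed n, since n C a vanishes for a > n; this keeps one bound N
-- through the recursion, as the tuples of the theorem do.
splittings : ℕ → ℕ → (ℕ → ℕ → ℕ) → ℕ
splittings N n c = sum (map (λ a → (n C a) * c a (n ∸ a)) (upTo (suc N)))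

-- The second size is forced to be `n ∸ a`. For a > n this truncated difference means nothing, but
-- then there is no split and the binomial coefficient vanishes.
count-splittings : ∀ {N n} {Y : ℕ → ℕ → Set} {Q : ∀ {a b} → Y a b → Set} {c : ℕ → ℕ → ℕ} → n ≤ N →
  (∀ a b → a + b ≡ n → CountIs (Q {a} {b}) (c a b)) →
  CountIs {Splitting n Y} (λ (_ , _ , _ , y) → Q y) (splittings N n c)
count-splittings {N} {n} {Y} {Q} {c} n≤N count =
  count-image (λ (a , σ , y) → a , n ∸ a , σ , y)
    (count-Σ {B = λ a → Split n a (n ∸ a) × Y a (n ∸ a)} {Q =
        λ _ (_ , y) → ⊤ × Q y} (upTo (suc N)) (Uniqueₚ.upTo⁺ _) _ (λ a _ → each a))
    (λ { _ _ refl → refl }) (λ { (_ , _ , q) → q })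
    (λ { {a , b , σ , y} q → complete σ y q })
  where
  each : ∀ a → CountIs {Split n a (n ∸ a) × Y a (n ∸ a)} (λ (_ , y) → ⊤ × Q y) ((n C a) * c a (n ∸ a))
  each a with a ℕ.≤? n
  ... | yes a≤n = count-× (count-split n a (n ∸ a) (ℕₚ.m+[n∸m]≡n a≤n)) (count a (n ∸ a) (ℕₚ.m+[n∸m]≡n a≤n))
  ... | no a≰n  = subst (λ k → CountIs {Split n a (n ∸ a) × Y a (n ∸ a)} (λ (_ , y) → ⊤ × Q y)
      (k * c a (n ∸ a))) (sym (k>n⇒nCk≡0 (ℕₚ.≰⇒> a≰n)))
    (count-∅ λ (σ , _) _ → a≰n (subst (a ≤_) (split-size σ) (ℕₚ.m≤m+n a _)))
  complete : ∀ {a b} (σ : Split n a b) (y : Y a b) → Q y →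
    ∃ λ x → (proj₁ x ∈ upTo (suc N) × ⊤ × Q (proj₂ (proj₂ x))) × (proj₁ x , n ∸ proj₁ x , proj₂ x) ≡
        (a , b , σ , y)
  complete {a} {b} σ y q
    with refl ← trans (cong (_∸ a) (sym (split-size σ))) (ℕₚ.m+n∸m≡n a b)
    = (a , σ , y) , (∈-upTo⁺ (s≤s (ℕₚ.≤-trans (subst (a ≤_) (split-size σ) (ℕₚ.m≤m+n a _)) n≤N)) , tt , q) ,
        refl

-- Symmetric matrices without switches

-- Here q = p + 2. The mid values are the p values strictly between 0 and q - 1, and their order is
-- irrelevant to switches.
data Val (p : ℕ) : Set where
  O T : Val p
  mid : Fin p → Val p

Pos Low : ∀ {p} → Val p → Set
Pos O = ⊥
Pos _ = ⊤
Low T = ⊥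
Low _ = ⊤

pos? : ∀ {p} (x : Val p) → Dec (Pos x)
pos? O       = no λ ()
pos? T       = yes tt
pos? (mid _) = yes tt

low? : ∀ {p} (x : Val p) → Dec (Low x)
low? O       = yes tt
low? T       = no λ ()
low? (mid _) = yes tt

¬pos⇒O : ∀ {p} {x : Val p} → ¬ Pos x → x ≡ O
¬pos⇒O {x = O}     _ = refl
¬pos⇒O {x = T}     ¬p = ⊥-elim (¬p tt)
¬pos⇒O {x = mid _} ¬p = ⊥-elim (¬p tt)

¬low⇒T : ∀ {p} {x : Val p} → ¬ Low x → x ≡ T
¬low⇒T {x = T}     _ = refl
¬low⇒T {x = O}     ¬l = ⊥-elim (¬l tt)
¬low⇒T {x = mid _} ¬l = ⊥-elim (¬l tt)

¬pos⇒low : ∀ {p} {x : Val p} → ¬ Pos x → Low x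
¬pos⇒low ¬p = subst Low (sym (¬pos⇒O ¬p)) tt

pick : ∀ {n} → 1 ≤ n → Fin n
pick (s≤s _) = zero

extremal : ∀ {n} {A : Set} (R : A → A → Set) → (∀ x y → R x y ⊎ R y x) → (∀ {x y z} → R x y → R y z → R x z) →
  (a : Fin (suc n) → A) → ∃ λ i → ∀ j → R (a i) (a j)
extremal {zero}  R total tr a = zero , λ { zero → [ id , id ] (total (a zero) (a zero)) }
extremal {suc n} R total tr a with extremal R total tr (a ∘ suc)
... | i , least with total (a zero) (a (suc i))
... | inj₁ 0≤i = zero , λ { zero → [ id , id ] (total (a zero) (a zero)) ; (suc j) → tr 0≤i (least j) }
... | inj₂ i≤0 = suc i , λ { zero → i≤0 ; (suc j) → least j }

module _ {p : ℕ} where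

  private
    Cell : Set
    Cell = Maybe (Fin p)

  -- Corner entries are never `O`, so an optional mid value describes them, and the marked cells are
  -- exactly the low ones.
  val : Cell → Val p
  val nothing  = T
  val (just d) = mid d

  -- The value at `O` is a default: `val-unval` inverts it at positive entries, and it is applied
  -- along full rows.
  unval : Val p → Cell
  unval (mid d) = just d
  unval _       = nothing

  val-pos : ∀ x → Pos (val x)
  val-pos nothing  = tt
  val-pos (just _) = tt

  val-unval : ∀ x → Pos x → val (unval x) ≡ x
  val-unval T       _ = refl
  val-unval (mid _) _ = refl

  val-injective : ∀ {x y} → val x ≡ val y → x ≡ y
  val-injective {nothing} {nothing} _    = refl
  val-injective {just _}  {just _}  refl = refl

  low⇒marked : ∀ x → Low (val x) → Marked x
  low⇒marked (just _) _ ()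

  marked⇒low : ∀ x → Marked (unval x) → Low x
  marked⇒low O       m = tt
  marked⇒low T       m = m refl
  marked⇒low (mid _) m = tt

  module _ {I : Set} (g : I → I → Val p) where

    -- The index set is arbitrary because block matrices are built over sums of `Fin` types and only
    -- then transported along a split.
    Symm NoSwitch SN NoZeroRow : Set
    Symm = ∀ i j → g i j ≡ g j i
    NoSwitch = ∀ i i' j j' → i ≢ i' → j ≢ j' →
      Pos (g i j) → Pos (g i' j') → Low (g i j') → Low (g i' j) → ⊥
    SN = Symm × NoSwitch
    NoZeroRow = ∀ i → ∃ λ j → Pos (g i j)

    ZeroRow FullRow : I → Set
    ZeroRow i = ∀ j → ¬ Pos (g i j)
    FullRow i = ∀ j → Pos (g i j)

  SN-via : {I J : Set} {g : I → I → Val p} (φ : J → I) → (∀ {x y} → φ x ≡ φ y → x ≡ y) →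
    SN g → SN (λ x y → g (φ x) (φ y))
  SN-via φ inj (s , ns) = (λ i j → s (φ i) (φ j)) ,
    λ i i' j j' i≢i' j≢j' → ns (φ i) (φ i') (φ j) (φ j') (i≢i' ∘ inj) (j≢j' ∘ inj)

  SN-resp : {I : Set} {g g' : I → I → Val p} → (∀ i j → g i j ≡ g' i j) → SN g → SN g'
  SN-resp {g = g} {g'} eq (s , ns) = (λ i j → trans (sym (eq i j)) (trans (s i j) (eq j i))) ,
    λ i i' j j' i≢i' j≢j' p₁ p₂ l₁ l₂ → ns i i' j j' i≢i' j≢j'
      (subst Pos (sym (eq i j)) p₁) (subst Pos (sym (eq i' j')) p₂)
      (subst Low (sym (eq i j')) l₁) (subst Low (sym (eq i' j)) l₂)

  -- Splitting off zero rows

  Square : ℕ → Set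
  Square n = Table (Val p) n n

  pad : ∀ {s k} → (Fin k → Fin k → Val p) → Fin s ⊎ Fin k → Fin s ⊎ Fin k → Val p
  pad h (inj₁ _) _        = O
  pad h (inj₂ _) (inj₁ _) = O
  pad h (inj₂ a) (inj₂ b) = h a b

  pad-O : ∀ {s k} (h : Fin k → Fin k → Val p) (x : Fin s ⊎ Fin k) l → pad h x (inj₁ l) ≡ O
  pad-O h (inj₁ _) l = refl
  pad-O h (inj₂ _) l = refl

  pad-SN : ∀ {s k} {h : Fin k → Fin k → Val p} → SN h → SN (pad {s} h)
  pad-SN {s} {k} {h} (sy , ns) = sy' , ns'
    where
    sy' : Symm (pad {s} h)
    sy' (inj₁ _) (inj₁ _) = refl
    sy' (inj₁ _) (inj₂ _) = refl
    sy' (inj₂ _) (inj₁ _) = refl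
    sy' (inj₂ a) (inj₂ b) = sy a b
    ns' : NoSwitch (pad {s} h)
    ns' (inj₁ _) _        _        _        _ _ ()
    ns' (inj₂ _) _        (inj₁ _) _        _ _ ()
    ns' (inj₂ _) (inj₁ _) (inj₂ _) _        _ _ _ ()
    ns' (inj₂ _) (inj₂ _) (inj₂ _) (inj₁ _) _ _ _ ()
    ns' (inj₂ i) (inj₂ i') (inj₂ j) (inj₂ j') i≢i' j≢j' = ns i i' j j' (i≢i' ∘ cong inj₂) (j≢j' ∘ cong inj₂)

  pad-decides : ∀ {n s k} {g : Fin n → Fin n → Val p} (σ : Split n s k) (h : Square k) → NoZeroRow (h ⟨_,_⟩) →
    (∀ i j → g i j ≡ pad (h ⟨_,_⟩) (side σ i) (side σ j)) → Decides σ (ZeroRow g)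
  pad-decides {g = g} σ h nz eq = zero-left , nonzero-right
    where
    eq' : ∀ x y → g (place σ x) (place σ y) ≡ pad (h ⟨_,_⟩) x y
    eq' x y = trans (eq _ _) (cong₂ (pad (h ⟨_,_⟩)) (side-place σ x) (side-place σ y))
    zero-left : ∀ i → ZeroRow g (place σ (inj₁ i))
    zero-left i j pos = subst Pos (trans (cong (g _) (sym (place-side σ j))) (eq' (inj₁ i) (side σ j))) pos
    nonzero-right : ∀ i → ¬ ZeroRow g (place σ (inj₂ i))
    nonzero-right i z with j , pos ← nz i = z (place σ (inj₂ j)) (subst Pos (sym (eq' (inj₂ i) (inj₂ j))) pos)

  SquareSplitting : ℕ → Set
  SquareSplitting n = Splitting n (λ _ k → Square k)

  -- As neither inner block has a zero row, both splits single out the zero rows of `g` and so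
  -- coincide; the inner blocks are then the same restriction of `g`.
  pad-unique : ∀ {n s k s' k'} {g : Fin n → Fin n → Val p}
    (σ : Split n s k) (h : Square k) (σ' : Split n s' k') (h' : Square k') →
    NoZeroRow (h ⟨_,_⟩) → NoZeroRow (h' ⟨_,_⟩) →
    (∀ i j → g i j ≡ pad (h ⟨_,_⟩) (side σ i) (side σ j)) →
    (∀ i j → g i j ≡ pad (h' ⟨_,_⟩) (side σ' i) (side σ' j)) →
    _≡_ {A = SquareSplitting n} (s , k , σ , h) (s' , k' , σ' , h')
  pad-unique {g = g} σ h σ' h' nz nz' eq eq'
    with split-unique σ σ' (ZeroRow g) (pad-decides σ h nz eq) (pad-decides σ' h' nz' eq')
  ... | same = cong (λ h → _ , _ , σ , h) (table-ext λ a b →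
    trans (sym (lower h eq a b)) (lower h' eq' a b))
    where
    lower : ∀ h → (∀ i j → g i j ≡ pad (h ⟨_,_⟩) (side σ i) (side σ j)) →
      ∀ a b → g (place σ (inj₂ a)) (place σ (inj₂ b)) ≡ h ⟨ a , b ⟩
    lower h eq a b = trans (eq _ _) (cong₂ (pad (h ⟨_,_⟩)) (side-place σ (inj₂ a)) (side-place σ (inj₂ b)))

  -- By symmetry the columns of the deleted rows vanish too, so a nonzero row keeps a positive entry
  -- after the deletion.
  pad-complete : ∀ {n} (g : Fin n → Fin n → Val p) → SN g →
    ∃₂ λ s k → Σ (Split n s k) λ σ → Σ (Square k) λ h →
      SN (h ⟨_,_⟩) × NoZeroRow (h ⟨_,_⟩) × Decides σ (ZeroRow g) ×
      (∀ x y → g (place σ x) (place σ y) ≡ pad (h ⟨_,_⟩) x y)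
  pad-complete {n} g sn@(sy , ns) with split-by {D = ZeroRow g} (λ i → Finₚ.all? λ j → ¬? (pos? (g i j)))
  ... | s , k , σ , l , r = s , k , σ , h ,
    SN-resp (λ a b → sym (h-eq a b)) (SN-via (place σ ∘ inj₂) (Sumₚ.inj₂-injective ∘ place-injective σ) sn) ,
    nz , (l , r) , eq
    where
    h : Square k
    h = table λ a b → g (place σ (inj₂ a)) (place σ (inj₂ b))
    h-eq : ∀ a b → h ⟨ a , b ⟩ ≡ g (place σ (inj₂ a)) (place σ (inj₂ b))
    h-eq = at-table _
    eq : ∀ x y → g (place σ x) (place σ y) ≡ pad (h ⟨_,_⟩) x y
    eq (inj₁ i) y        = ¬pos⇒O (l i (place σ y))
    eq (inj₂ a) (inj₁ j) = trans (sy _ _) (¬pos⇒O (l j (place σ (inj₂ a))))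
    eq (inj₂ a) (inj₂ b) = sym (h-eq a b)
    nz : NoZeroRow (h ⟨_,_⟩)
    nz a with Finₚ.any? (λ b → pos? (h ⟨ a , b ⟩))
    ... | yes found = found
    ... | no none   = ⊥-elim (r a λ j pos → below (side σ j)
        (subst (λ j → Pos (g _ j)) (sym (place-side σ j)) pos))
      where
      below : ∀ y → ¬ Pos (g (place σ (inj₂ a)) (place σ y))
      below (inj₁ j) pos = subst Pos (eq (inj₂ a) (inj₁ j)) pos
      below (inj₂ b) pos = none (b , subst Pos (eq (inj₂ a) (inj₂ b)) pos)

  -- Bordering by full rows

  corner : ∀ {r s k} → Table Cell r s → Fin r → Fin s ⊎ Fin k → Val p
  corner F a (inj₁ l) = val (F ⟨ a , l ⟩)
  corner F a (inj₂ _) = T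

  corner-pos : ∀ {r s k} (F : Table Cell r s) a (y : Fin s ⊎ Fin k) → Pos (corner F a y)
  corner-pos F a (inj₁ l) = val-pos _
  corner-pos F a (inj₂ _) = tt

  -- The summands index the full rows, the rows supported exactly on them, and the rest.
  border : ∀ {r s k} → Table Cell r s → (Fin k → Fin k → Val p) →
    Fin r ⊎ (Fin s ⊎ Fin k) → Fin r ⊎ (Fin s ⊎ Fin k) → Val p
  border F h (inj₁ _) (inj₁ _) = T
  border F h (inj₁ a) (inj₂ y) = corner F a y
  border F h (inj₂ x) (inj₁ b) = corner F b x
  border F h (inj₂ x) (inj₂ y) = pad h x y

  border-pos : ∀ {r s k} (F : Table Cell r s) (h : Fin k → Fin k → Val p) a y → Pos (border F h (inj₁ a) y)
  border-pos F h a (inj₁ _) = tt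
  border-pos F h a (inj₂ y) = corner-pos F a y

  border-symm : ∀ {r s k} (F : Table Cell r s) {h : Fin k → Fin k → Val p} → SN h → Symm (border F h)
  border-symm F sn (inj₁ _) (inj₁ _) = refl
  border-symm F sn (inj₁ _) (inj₂ _) = refl
  border-symm F sn (inj₂ _) (inj₁ _) = refl
  border-symm F sn (inj₂ x) (inj₂ y) = proj₁ (pad-SN sn) x y

  -- In a full row only entries of the `r × s` corner can be low. A switch through a full row
  -- therefore has a low corner entry in some column of the second class; that column is zero
  -- outside the full rows, so the other row is full as well, and the two low entries contradict
  -- collinearity. Swapping the rows or transposing brings every switch that meets the first class
  -- into this form; the others lie in `pad h`.
  border-SN : ∀ {r s k} {F : Table Cell r s} {h : Fin k → Fin k → Val p} → Collinear F → SN h → SN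
      (border F h)
  border-SN {r} {s} {k} {F} {h} coll sn = sy , ns
    where
    g : Fin r ⊎ (Fin s ⊎ Fin k) → Fin r ⊎ (Fin s ⊎ Fin k) → Val p
    g = border F h
    sy : Symm g
    sy = border-symm F sn
    full-row : ∀ a i' j j' → inj₁ a ≢ i' → j ≢ j' →
      Pos (g (inj₁ a) j) → Pos (g i' j') → Low (g (inj₁ a) j') → Low (g i' j) → ⊥
    full-row a i' j (inj₁ _) _ _ _ _ () _
    full-row a i' j (inj₂ (inj₂ _)) _ _ _ _ () _
    full-row a (inj₂ x) j (inj₂ (inj₁ l')) _ _ _ pos _ _ = subst Pos (pad-O h x l') pos
    full-row a (inj₁ a') (inj₁ _) (inj₂ (inj₁ l')) _ _ _ _ _ ()
    full-row a (inj₁ a') (inj₂ (inj₂ _)) (inj₂ (inj₁ l')) _ _ _ _ _ ()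
    full-row a (inj₁ a') (inj₂ (inj₁ l)) (inj₂ (inj₁ l')) i≢i' j≢j' _ _ low low'
      with coll a a' l' l (low⇒marked _ low) (low⇒marked _ low')
    ... | inj₁ refl = i≢i' refl
    ... | inj₂ refl = j≢j' refl
    ns : NoSwitch g
    ns (inj₁ a) i' j j' = full-row a i' j j'
    ns (inj₂ x) (inj₁ a) j j' i≢i' j≢j' p₁ p₂ l₁ l₂ =
        full-row a (inj₂ x) j' j (i≢i' ∘ sym) (j≢j' ∘ sym) p₂ p₁ l₂ l₁
    ns i@(inj₂ x) i'@(inj₂ x') (inj₁ b) j' i≢i' j≢j' p₁ p₂ l₁ l₂ =
      full-row b j' i i' j≢j' i≢i' (subst Pos (sy i (inj₁ b)) p₁) (subst Pos (sy i' j') p₂)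
        (subst Low (sy i' (inj₁ b)) l₂) (subst Low (sy i j') l₁)
    ns i@(inj₂ x) i'@(inj₂ x') j@(inj₂ y) (inj₁ b) i≢i' j≢j' p₁ p₂ l₁ l₂ =
      full-row b j i' i (j≢j' ∘ sym) (i≢i' ∘ sym) (subst Pos (sy i' (inj₁ b)) p₂) (subst Pos (sy i j) p₁)
        (subst Low (sy i (inj₁ b)) l₁) (subst Low (sy i' j) l₂)
    ns (inj₂ x) (inj₂ x') (inj₂ y) (inj₂ y') i≢i' j≢j' =
      proj₂ (pad-SN sn) x x' y y' (i≢i' ∘ cong inj₂) (j≢j' ∘ cong inj₂)

  Bordering : ℕ → Set
  Bordering n = Splitting n λ r m → Splitting m λ s k → Table Cell r s × Square k

  bordered : ∀ {n} → Bordering n → Square n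
  bordered (_ , _ , τ , _ , _ , σ , F , h) =
      table λ i j → border F (h ⟨_,_⟩) (classify τ σ i) (classify τ σ j)

  -- A nonempty first class gives a column without zeros, so that no row vanishes. A nonempty second
  -- class puts a zero into every row outside the first, so that the first class consists of all
  -- full rows.
  Valid : ∀ {n} → Bordering n → Set
  Valid (r , _ , τ , s , _ , σ , F , h) = 1 ≤ r × 1 ≤ s × Collinear F × SN (h ⟨_,_⟩) × NoZeroRow (h ⟨_,_⟩)

  Core : ∀ {n} → Square n → Set
  Core M = SN (M ⟨_,_⟩) × NoZeroRow (M ⟨_,_⟩)

  HasZero : ∀ {n} → Square n → Set
  HasZero M = ∃₂ λ i j → ¬ Pos (M ⟨ i , j ⟩)

  at-bordered-classify : ∀ {n r m s k} (τ : Split n r m) (σ : Split m s k) F (h : Square k) i j →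
    bordered (_ , _ , τ , _ , _ , σ , F , h) ⟨ i , j ⟩ ≡ border F (h ⟨_,_⟩) (classify τ σ i) (classify τ σ j)
  at-bordered-classify τ σ F h = at-table λ i j → border F (h ⟨_,_⟩) (classify τ σ i) (classify τ σ j)

  at-bordered : ∀ {n r m s k} (τ : Split n r m) (σ : Split m s k) F (h : Square k) x y →
    bordered (_ , _ , τ , _ , _ , σ , F , h) ⟨ locate τ σ x , locate τ σ y ⟩ ≡ border F (h ⟨_,_⟩) x y
  at-bordered τ σ F h x y = trans (at-bordered-classify τ σ F h _ _)
    (cong₂ (border F (h ⟨_,_⟩)) (classify-locate τ σ x) (classify-locate τ σ y))

  bordered-sound : ∀ {n} {B : Bordering n} → Valid B → Core (bordered B) × HasZero (bordered B)
  bordered-sound {n} {B@(_ , _ , τ , _ , _ , σ , F , h)} (r≥1 , s≥1 , coll , sn , nz) =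
    (SN-resp (λ i j → sym (at-table _ i j))
        (SN-via (classify τ σ) (classify-injective τ σ) (border-SN {F = F} coll sn)) ,
     λ i → locate τ σ u , subst Pos (sym (cell i u))
         (subst Pos (border-symm F sn u (classify τ σ i)) (border-pos F (h ⟨_,_⟩) a (classify τ σ i)))) ,
    locate τ σ z , locate τ σ z , subst Pos (at-bordered τ σ F h z z)
    where
    a = pick r≥1
    u = inj₁ a
    z = inj₂ (inj₁ (pick s≥1))
    cell : ∀ i y → bordered B ⟨ i , locate τ σ y ⟩ ≡ border F (h ⟨_,_⟩) (classify τ σ i) y
    cell i y = trans (at-bordered-classify τ σ F h _ _)
        (cong (border F (h ⟨_,_⟩) (classify τ σ i)) (classify-locate τ σ y))

  bordered-decides : ∀ {n r m s k} (τ : Split n r m) (σ : Split m s k) F (h : Square k) → 1 ≤ s →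
    Decides τ (FullRow (bordered (_ , _ , τ , _ , _ , σ , F , h) ⟨_,_⟩))
  bordered-decides {n} {r} {m} {s} {k} τ σ F h s≥1 = full-left , other-right
    where
    M : Square n
    M = bordered (_ , _ , τ , _ , _ , σ , F , h)
    full-left : ∀ a → FullRow (M ⟨_,_⟩) (place τ (inj₁ a))
    full-left a j = subst (λ j → Pos (M ⟨ place τ (inj₁ a) , j ⟩)) (locate-classify τ σ j)
      (subst Pos (sym (at-bordered τ σ F h (inj₁ a) (classify τ σ j)))
          (border-pos F (h ⟨_,_⟩) a (classify τ σ j)))
    other-right : ∀ x → ¬ FullRow (M ⟨_,_⟩) (place τ (inj₂ x))
    other-right x full = subst Pos (trans
      (subst (λ x → M ⟨ place τ (inj₂ x) , locate τ σ z ⟩ ≡ border F (h ⟨_,_⟩) (inj₂ (side σ x)) z)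
          (place-side σ x)
        (trans (at-bordered τ σ F h (inj₂ (side σ x)) z)
            (cong (λ y → border F (h ⟨_,_⟩) (inj₂ y) z) (sym (cong (side σ) (place-side σ x))))))
      (pad-O (h ⟨_,_⟩) (side σ x) l)) (full (locate τ σ z))
      where
      l = pick s≥1
      z : Fin r ⊎ (Fin s ⊎ Fin k)
      z = inj₂ (inj₁ l)

  -- The layers are recovered one after another: `τ` from the full rows, `σ` and `h` from the zero
  -- rows of the remaining block, and `F` from the corner entries.
  bordered-injective : ∀ {n} {B B' : Bordering n} → Valid B → Valid B' → bordered B ≡ bordered B' → B ≡ B'
  bordered-injective {n} {B@(_ , _ , τ , _ , _ , σ , F , h)} {B'@(_ , _ , τ' , _ , _ , σ' , F' , h')}
    (_ , s≥1 , _ , _ , nz) (_ , s'≥1 , _ , _ , nz') eq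
    with split-unique τ τ' (FullRow (bordered B ⟨_,_⟩)) (bordered-decides τ σ F h s≥1)
           (subst (λ M → Decides τ' (FullRow (M ⟨_,_⟩))) (sym eq) (bordered-decides τ' σ' F' h' s'≥1))
  ... | same with pad-unique {g =
      λ a b → bordered B ⟨ place τ (inj₂ a) , place τ (inj₂ b) ⟩} σ h σ' h' nz nz' rest
         (λ i j → trans (cong (_⟨ place τ (inj₂ i) , place τ (inj₂ j) ⟩) eq) (rest' i j))
    where
    rest : ∀ i j → bordered B ⟨ place τ (inj₂ i) , place τ (inj₂ j) ⟩ ≡ pad (h ⟨_,_⟩) (side σ i) (side σ j)
    rest i j = trans (at-bordered-classify τ σ F h _ _)
        (cong₂ (λ x y → border F (h ⟨_,_⟩) (Sum.map₂ (side σ) x) (Sum.map₂ (side σ) y))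
          (side-place τ (inj₂ i)) (side-place τ (inj₂ j)))
    rest' : ∀ i j → bordered B' ⟨ place τ (inj₂ i) , place τ (inj₂ j) ⟩ ≡ pad (h' ⟨_,_⟩) (side σ' i)
        (side σ' j)
    rest' i j = trans (at-bordered-classify τ σ' F' h' _ _)
        (cong₂ (λ x y → border F' (h' ⟨_,_⟩) (Sum.map₂ (side σ') x) (Sum.map₂ (side σ') y))
          (side-place τ (inj₂ i)) (side-place τ (inj₂ j)))
  ... | refl = cong (λ F → _ , _ , τ , _ , _ , σ , F , h) (table-ext λ a l → val-injective
    (trans (sym (at-bordered τ σ F h (inj₁ a) (inj₂ (inj₁ l))))
      (trans (cong (_⟨ locate τ σ (inj₁ a) , locate τ σ (inj₂ (inj₁ l)) ⟩) eq)
          (at-bordered τ σ F' h (inj₁ a) (inj₂ (inj₁ l))))))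

  -- Comparing the supports of rows

  module _ {n : ℕ} {g : Fin n → Fin n → Val p} (ns : NoSwitch g) where

    _⊆ʳ_ : Fin n → Fin n → Set
    i ⊆ʳ i' = ∀ j → Pos (g i j) → Pos (g i' j)

    -- Two incomparable supports give a switch whose low entries are zeros.
    ⊆ʳ-total : ∀ i i' → i ⊆ʳ i' ⊎ i' ⊆ʳ i
    ⊆ʳ-total i i' with Finₚ.any? (λ j → pos? (g i j) ×-dec ¬? (pos? (g i' j)))
    ... | no none = inj₁ λ j pos → decidable-stable (pos? _) λ ¬pos → none (j , pos , ¬pos)
    ... | yes (j , pos , ¬pos) = inj₂ λ j' pos' → decidable-stable (pos? _) λ ¬pos' →
      ns i i' j j' (λ { refl → ¬pos pos }) (λ { refl → ¬pos pos' }) pos pos' (¬pos⇒low ¬pos') (¬pos⇒low ¬pos)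

  -- By symmetry every column has a positive entry, and the row with the largest support is positive
  -- wherever some row is.
  full-row-exists : ∀ {n} {g : Fin n → Fin n → Val p} → SN g → NoZeroRow g → Fin n → ∃ (FullRow g)
  full-row-exists {suc n} {g} (sy , ns) nz _
    with i , biggest ← extremal (λ x y → _⊆ʳ_ ns y x) (λ x y → ⊆ʳ-total ns y x) (λ xy yz j → xy j ∘ yz j) id =
    i , λ j → let j' , pos = nz j in biggest j' j (subst Pos (sy j j') pos)

  -- A column in which the row of least support is positive is positive throughout, and by symmetry
  -- it is a full row.
  zero-row-exists : ∀ {n} {g : Fin n → Fin n → Val p} → SN g → (∀ i → ¬ FullRow g i) → Fin n → ∃ (ZeroRow g)
  zero-row-exists {suc n} {g} (sy , ns) nf _
    with i , least ← extremal (_⊆ʳ_ ns) (⊆ʳ-total ns) (λ xy yz j → yz j ∘ xy j) id =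
    i , λ j pos → nf j λ j' → subst Pos (sy j' j) (least j' j pos)

  bordered-complete : ∀ {n} (M : Square n) → Core M → HasZero M → ∃ λ B → Valid B × bordered B ≡ M
  bordered-complete {n} M (sn@(sy , ns) , nz) (i₀ , j₀ , zero₀)
    with split-by {D = FullRow (M ⟨_,_⟩)} (λ i → Finₚ.all? λ j → pos? (M ⟨ i , j ⟩))
  ... | r , m , τ , full , other
    with pad-complete (λ a b → M ⟨ place τ (inj₂ a) , place τ (inj₂ b) ⟩)
        (SN-via (place τ ∘ inj₂) (Sumₚ.inj₂-injective ∘ place-injective τ) sn)
  ... | s , k , σ , h , sn-h , nz-h , decides-σ , rest-eq =
    (r , m , τ , s , k , σ , F , h) , (r≥1 , s≥1 , coll , sn-h , nz-h) ,
    table-ext λ i j → trans (at-bordered-classify τ σ F h i j)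
      (trans (sym (eq (classify τ σ i) (classify τ σ j)))
          (cong₂ (M ⟨_,_⟩) (locate-classify τ σ i) (locate-classify τ σ j)))
    where
    g : Fin n → Fin n → Val p
    g = M ⟨_,_⟩
    up : Fin r → Fin n
    up a = place τ (inj₁ a)
    rest : Fin s ⊎ Fin k → Fin n
    rest y = place τ (inj₂ (place σ y))
    r≥1 : 1 ≤ r
    r≥1 = left-inhabited τ (full , other) (full-row-exists sn nz i₀)
    rest₀ : Fin m
    rest₀ with side τ i₀ | place-side τ i₀
    ... | inj₁ a | refl = ⊥-elim (zero₀ (full a j₀))
    ... | inj₂ x | _    = x
    -- Entries in the columns of full rows are positive by symmetry, so a full row of the remaining
    -- block would be full in `M`.
    rest-not-full : ∀ x → ¬ (∀ y → Pos (g (place τ (inj₂ x)) (place τ (inj₂ y))))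
    rest-not-full x pos = other x λ j → subst (Pos ∘ g _) (place-side τ j) (cases (side τ j))
      where
      cases : ∀ y → Pos (g (place τ (inj₂ x)) (place τ y))
      cases (inj₁ a) = subst Pos (sy _ _) (full a _)
      cases (inj₂ y) = pos y
    s≥1 : 1 ≤ s
    s≥1 = left-inhabited σ decides-σ
        (zero-row-exists (SN-via (place τ ∘ inj₂)
          (Sumₚ.inj₂-injective ∘ place-injective τ) sn) rest-not-full rest₀)
    z : Fin n
    z = rest (inj₁ (pick s≥1))
    z-zero : ∀ y → ¬ Pos (g z (rest y))
    z-zero y = subst Pos (rest-eq (inj₁ _) y)
    up-injective : ∀ {a b} → up a ≡ up b → a ≡ b
    up-injective = Sumₚ.inj₁-injective ∘ place-injective τ
    rest-injective : ∀ {x y} → rest x ≡ rest y → x ≡ y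
    rest-injective = place-injective σ ∘ Sumₚ.inj₂-injective ∘ place-injective τ
    up≢rest : ∀ {a y} → up a ≢ rest y
    up≢rest eq with () ← place-injective τ eq
    -- The zero at `(z , z)` and a low entry at `(up a , up b)` would form a switch with the
    -- positive entries at `(up a , z)` and `(z , up b)`.
    up-up : ∀ a b → g (up a) (up b) ≡ T
    up-up a b = ¬low⇒T λ low → ns (up a) z z (up b) up≢rest (up≢rest ∘ sym) (full a z)
      (subst Pos (sy _ _) (full b z)) low (¬pos⇒low (z-zero _))
    -- Row b of `h` is positive at some b', so a low entry here would form a switch with the zero in
    -- row `rest (inj₂ b')` and column `z`.
    up-mid : ∀ a b → g (up a) (rest (inj₂ b)) ≡ T
    up-mid a b with b' , pos ← nz-h b = ¬low⇒T λ low →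
      ns (up a) (rest (inj₂ b')) z (rest (inj₂ b)) up≢rest
        (λ eq → z-zero (inj₂ b') (subst (λ i → Pos (g i (rest (inj₂ b')))) (sym eq)
            (subst Pos (sym (rest-eq (inj₂ b) (inj₂ b'))) pos)))
        (full a z) (subst Pos (trans (sym (rest-eq (inj₂ b) (inj₂ b'))) (sy _ _)) pos) low
        (subst Low (sy z _) (¬pos⇒low (z-zero _)))
    F : Table Cell r s
    F = table λ a l → unval (g (up a) (rest (inj₁ l)))
    F-eq : ∀ a l → F ⟨ a , l ⟩ ≡ unval (g (up a) (rest (inj₁ l)))
    F-eq = at-table _
    coll : Collinear F
    coll i i' j j' m₁ m₂ with i Fin.≟ i' | j Fin.≟ j'
    ... | yes eq | _      = inj₁ eq
    ... | no _   | yes eq = inj₂ eq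
    ... | no i≢i' | no j≢j' = ⊥-elim (ns (up i) (up i') (rest (inj₁ j')) (rest (inj₁ j))
      (i≢i' ∘ up-injective) (j≢j' ∘ sym ∘ Sumₚ.inj₁-injective ∘ rest-injective) (full i _) (full i' _)
      (marked⇒low _ (subst Marked (F-eq i j) m₁)) (marked⇒low _ (subst Marked (F-eq i' j') m₂)))
    corner-eq : ∀ a y → g (up a) (rest y) ≡ corner F a y
    corner-eq a (inj₁ l) = sym (trans (cong val (F-eq a l)) (val-unval _ (full a _)))
    corner-eq a (inj₂ b) = up-mid a b
    eq : ∀ x y → g (locate τ σ x) (locate τ σ y) ≡ border F (h ⟨_,_⟩) x y
    eq (inj₁ a) (inj₁ b) = up-up a b
    eq (inj₁ a) (inj₂ y) = corner-eq a y
    eq (inj₂ x) (inj₁ b) = trans (sy _ _) (corner-eq b x)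
    eq (inj₂ x) (inj₂ y) = rest-eq x y

  -- Counting switch-free matrices

  AllPos : ∀ {n} → Square n → Set
  AllPos M = ∀ i j → Pos (M ⟨ i , j ⟩)

  spike : ∀ {n} → Fin n → Fin p → Fin n → Fin n → Val p
  spike i d a b with a Fin.≟ i | b Fin.≟ i
  ... | yes _ | yes _ = mid d
  ... | _     | _     = T

  spike-pos : ∀ {n} (i : Fin n) d a b → Pos (spike i d a b)
  spike-pos i d a b with a Fin.≟ i | b Fin.≟ i
  ... | yes _ | yes _ = tt
  ... | yes _ | no _  = tt
  ... | no _  | _     = tt

  spike-symm : ∀ {n} (i : Fin n) d → Symm (spike i d)
  spike-symm i d a b with a Fin.≟ i | b Fin.≟ i
  ... | yes _ | yes _ = refl
  ... | yes _ | no _  = refl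
  ... | no _  | yes _ = refl
  ... | no _  | no _  = refl

  spike-low : ∀ {n} (i : Fin n) d a b → Low (spike i d a b) → a ≡ i × b ≡ i
  spike-low i d a b low with a Fin.≟ i | b Fin.≟ i
  ... | yes eq | yes eq' = eq , eq'
  ... | yes _ | no _  = ⊥-elim low
  ... | no _  | _     = ⊥-elim low

  spike-tip : ∀ {n} (i : Fin n) d → spike i d i i ≡ mid d
  spike-tip i d with i Fin.≟ i
  ... | yes _ = refl
  ... | no i≢i = ⊥-elim (i≢i refl)

  -- With all entries positive, any two low entries in distinct rows and columns make a switch. An
  -- off-diagonal low entry makes one with its mirror image, and two diagonal ones make one
  -- together; at most one diagonal entry can be mid.
  count-all-pos : ∀ n → CountIs {Square n} (λ M → SN (M ⟨_,_⟩) × AllPos M) (1 + n * p)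
  count-all-pos n = count-cong join split (count-⊎ (count-≡ (table λ _ _ → T)) spikes disjoint)
    where
    Spike : Square n → Set
    Spike M = ∃₂ λ i d → table (spike i d) ≡ M
    spikes : CountIs Spike (n * p)
    spikes = count-image (λ (i , d) → table (spike i d)) (count-× (count-Fin n) (count-Fin p)) inj
      (λ {(i , d)} _ → i , d , refl) (λ { (i , d , eq) → (i , d) , (tt , tt) , eq })
      where
      inj : ∀ {x y : Fin n × Fin p} → _ → _ → table (spike (proj₁ x) (proj₂ x)) ≡ table
          (spike (proj₁ y) (proj₂ y)) → x ≡ y
      inj {i , d} {i' , d'} _ _ eq =
          tip (trans (sym (at-table _ i i)) (trans (cong (_⟨ i , i ⟩) eq) (at-table _ i i)))
        where
        tip : spike i d i i ≡ spike i' d' i i → (i , d) ≡ (i' , d')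
        tip eq with refl , _ ← spike-low i' d' i i (subst Low eq (subst Low (sym (spike-tip i d)) tt))
          with refl ← trans (sym (spike-tip i d)) (trans eq (spike-tip i d')) = refl
    disjoint : ∀ M → M ≡ table (λ _ _ → T) → Spike M → ⊥
    disjoint _ refl (i , d , eq)
      with () ← trans (sym (trans (at-table _ i i) (spike-tip i d)))
          (trans (cong (_⟨ i , i ⟩) eq) (at-table _ i i))
    join : ∀ M → M ≡ table (λ _ _ → T) ⊎ Spike M → SN (M ⟨_,_⟩) × AllPos M
    join _ (inj₁ refl) = SN-resp (λ i j → sym (at-table _ i j)) ((λ _ _ → refl) , λ _ _ _ _ _ _ _ _ ()) ,
      λ i j → subst Pos (sym (at-table _ i j)) tt
    join _ (inj₂ (i , d , refl)) = SN-resp (λ i j → sym (at-table _ i j)) (spike-symm i d , ns) ,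
      λ a b → subst Pos (sym (at-table _ a b)) (spike-pos i d a b)
      where
      ns : NoSwitch (spike i d)
      ns a a' b b' a≢a' _ _ _ low low' =
        a≢a' (trans (proj₁ (spike-low i d a b' low)) (sym (proj₁ (spike-low i d a' b low'))))
    split : ∀ M → SN (M ⟨_,_⟩) × AllPos M → M ≡ table (λ _ _ → T) ⊎ Spike M
    split M ((sy , ns) , pos) with Finₚ.any? (λ i → low? (M ⟨ i , i ⟩))
    ... | no none = inj₁ (table-ext λ a b → trans (¬low⇒T (high a b)) (sym (at-table _ a b)))
      where
      high : ∀ a b → ¬ Low (M ⟨ a , b ⟩)
      high a b low with a Fin.≟ b
      ... | yes refl = none (a , low)
      ... | no a≢b  = ns a b a b a≢b a≢b (pos _ _) (pos _ _) low (subst Low (sy a b) low)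
    ... | yes (i , low) = inj₂ (i , proj₁ tip , table-ext λ a b → trans (at-table _ a b) (cell a b))
      where
      value : ∀ x → Pos x → Low x → ∃ λ d → mid d ≡ x
      value (mid d) _ _ = d , refl
      tip = value (M ⟨ i , i ⟩) (pos i i) low
      high : ∀ a b → (a ≡ i → b ≢ i) → ¬ Low (M ⟨ a , b ⟩)
      high a b ab low' with a Fin.≟ b
      ... | no a≢b  = ns a b a b a≢b a≢b (pos _ _) (pos _ _) low' (subst Low (sy a b) low')
      ... | yes refl with a Fin.≟ i
      ...   | yes refl = ab refl refl
      ...   | no a≢i   = ns a i i a a≢i (a≢i ∘ sym) (pos _ _) (pos _ _) low' low
      cell : ∀ a b → spike i (proj₁ tip) a b ≡ M ⟨ a , b ⟩
      cell a b with a Fin.≟ i | b Fin.≟ i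
      ... | yes refl | yes refl = proj₂ tip
      ... | yes refl | no b≢i  = sym (¬low⇒T (high a b λ _ → b≢i))
      ... | no a≢i  | _        = sym (¬low⇒T (high a b λ a≡i → ⊥-elim (a≢i a≡i)))

-- `collinear` equals 1 when a side is empty, whereas an empty class must contribute nothing.
cornerCount : ℕ → ℕ → ℕ → ℕ
cornerCount p zero    _       = 0
cornerCount p (suc r) zero    = 0
cornerCount p (suc r) (suc s) = collinear {p} (suc r) (suc s)

-- J bounds the size n; it drops by 2 because both deleted classes are nonempty.
coreCount : ℕ → ℕ → ℕ → ℕ → ℕ
coreCount p N zero          n = 1 + n * p
coreCount p N (suc zero)    n = 1 + n * p
coreCount p N (suc (suc J)) n = (1 + n * p) +
  splittings N n λ r m → splittings N m λ s k → cornerCount p r s * coreCount p N J k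

-- Counting layer by layer

module _ {p : ℕ} where

  Bordered : ∀ {n} → Square {p} n → Set
  Bordered M = Core M × HasZero M

  count-core-by : ∀ {n k} → CountIs {Square {p} n} Bordered k → CountIs {Square {p} n} Core ((1 + n * p) + k)
  count-core-by {n} count = count-cong join split
      (count-⊎ (count-all-pos n) count λ { M (_ , pos) (_ , i , j , ¬pos) → ¬pos (pos i j) })
    where
    join : ∀ M → (SN (M ⟨_,_⟩) × AllPos M) ⊎ Bordered M → Core M
    join M (inj₁ (sn , pos)) = sn , λ i → i , pos i i
    join M (inj₂ (core , _)) = core
    split : ∀ M → Core M → (SN (M ⟨_,_⟩) × AllPos M) ⊎ Bordered M
    split M core@(sn , nz) with Finₚ.any? (λ i → Finₚ.any? λ j → ¬? (pos? (M ⟨ i , j ⟩)))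
    ... | yes found = inj₂ (core , found)
    ... | no none   = inj₁ (sn , λ i j → decidable-stable (pos? _) λ ¬pos → none (i , j , ¬pos))

  valid-size : ∀ {n} (B : Bordering {p} n) → Valid B → 2 ≤ n
  valid-size (r , m , τ , s , k , σ , _) (r≥1 , s≥1 , _) = ℕₚ.≤-trans
    (ℕₚ.+-mono-≤ r≥1 (ℕₚ.≤-trans (ℕₚ.≤-trans s≥1 (ℕₚ.m≤m+n s k)) (ℕₚ.≤-reflexive (split-size σ))))
    (ℕₚ.≤-reflexive (split-size τ))

  no-bordered : ∀ {n} → n ≤ 1 → (M : Square {p} n) → ¬ Bordered M
  no-bordered n≤1 M (core , hz) =
    let B , valid , _ = bordered-complete M core hz in ℕₚ.<⇒≱ (valid-size B valid) n≤1

  -- A border takes at least two indices. Hence for n ≤ 1 only positive matrices remain, and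
  -- otherwise the inner size k stays within the bound lowered by 2.
  count-core : ∀ {N} J {n} → n ≤ J → n ≤ N → CountIs {Square {p} n} Core (coreCount p N J n)
  count-core zero       n≤J _ =
      subst (CountIs Core) (ℕₚ.+-identityʳ _) (count-core-by (count-∅ (no-bordered (ℕₚ.≤-trans n≤J z≤n))))
  count-core (suc zero) n≤J _ =
      subst (CountIs Core) (ℕₚ.+-identityʳ _) (count-core-by (count-∅ (no-bordered n≤J)))
  count-core {N} (suc (suc J)) {n} n≤J n≤N = count-core-by
    (count-image bordered
      (count-splittings n≤N λ r m r+m → count-splittings (m≤N r+m) λ s k s+k → inner r s
          (trans (cong (λ k → r + k) s+k) r+m))
      (λ {B} {B'} v v' → bordered-injective {B = B} {B'} v v')
      (λ {B} → bordered-sound {B = B})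
      (λ {M} (core , hz) → bordered-complete M core hz))
    where
    m≤N : ∀ {r m} → r + m ≡ n → m ≤ N
    m≤N {r} {m} eq = ℕₚ.≤-trans (ℕₚ.m≤n+m m r) (ℕₚ.≤-trans (ℕₚ.≤-reflexive eq) n≤N)
    inner : ∀ r s {k} → r + (s + k) ≡ n → CountIs {Table (Maybe (Fin p)) r s × Square k}
      (λ (F , h) → 1 ≤ r × 1 ≤ s × Collinear F × SN (h ⟨_,_⟩) × NoZeroRow (h ⟨_,_⟩))
          (cornerCount p r s * coreCount p N J k)
    inner zero    s       _ = count-∅ λ { _ (() , _) }
    inner (suc r) zero    _ = count-∅ λ { _ (_ , () , _) }
    inner (suc r) (suc s) {k} eq =
        count-cong (λ { _ (coll , core) → s≤s z≤n , s≤s z≤n , coll , core })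
          (λ { _ (_ , _ , coll , core) → coll , core })
      (count-× count-collinear (count-core J k≤J (ℕₚ.≤-trans k≤n n≤N)))
      where
      size : suc (suc (r + (s + k))) ≡ n
      size = trans (cong suc (sym (ℕₚ.+-suc r (s + k)))) eq
      k≤ : k ≤ r + (s + k)
      k≤ = ℕₚ.≤-trans (ℕₚ.m≤n+m k s) (ℕₚ.m≤n+m (s + k) r)
      k≤J : k ≤ J
      k≤J = ℕₚ.≤-trans k≤ (ℕₚ.≤-pred (ℕₚ.≤-pred (ℕₚ.≤-trans (ℕₚ.≤-reflexive size) n≤J)))
      k≤n : k ≤ n
      k≤n = ℕₚ.≤-trans k≤ (ℕₚ.≤-trans (ℕₚ.m≤n+m _ 2) (ℕₚ.≤-reflexive size))

  count-SN : ∀ n → CountIs {Square {p} n} (λ M → SN (M ⟨_,_⟩)) (splittings n n λ _ k → coreCount p n n k)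
  count-SN n = count-image padded
    (count-splittings {Q = λ {_} {k} h → Core {p} {k} h} ℕₚ.≤-refl λ a b eq → count-core n (b≤n a b eq)
        (b≤n a b eq))
    (λ {x} {y} → inj {x} {y}) (λ {x} → sound {x}) complete
    where
    b≤n : ∀ a b → a + b ≡ n → b ≤ n
    b≤n a b eq = ℕₚ.≤-trans (ℕₚ.m≤n+m b a) (ℕₚ.≤-reflexive eq)
    padded : SquareSplitting {p} n → Square {p} n
    padded (_ , _ , σ , h) = table λ i j → pad (h ⟨_,_⟩) (side σ i) (side σ j)
    at-padded : ∀ {s k} (σ : Split n s k) h i j → padded (s , k , σ , h) ⟨ i , j ⟩ ≡ pad (h ⟨_,_⟩) (side σ i)
        (side σ j)
    at-padded σ h = at-table λ i j → pad (h ⟨_,_⟩) (side σ i) (side σ j)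
    inj : ∀ {x y : SquareSplitting {p} n} → Core (proj₂ (proj₂ (proj₂ x))) → Core (proj₂ (proj₂ (proj₂ y))) →
        padded x ≡ padded y → x ≡ y
    inj {_ , _ , σ , h} {_ , _ , σ' , h'} (_ , nz) (_ , nz') eq =
      pad-unique σ h σ' h' nz nz' (at-padded σ h) λ i j → trans (cong (_⟨ i , j ⟩) eq) (at-padded σ' h' i j)
    sound : ∀ {x : SquareSplitting {p} n} → Core (proj₂ (proj₂ (proj₂ x))) → SN (padded x ⟨_,_⟩)
    sound {_ , _ , σ , h} (sn , _) =
        SN-resp (λ i j → sym (at-padded σ h i j)) (SN-via {g =
          pad (h ⟨_,_⟩)} (side σ) (side-injective σ) (pad-SN sn))
    complete : ∀ {M} → SN (M ⟨_,_⟩) → ∃ λ (x : SquareSplitting {p} n) → Core (proj₂ (proj₂ (proj₂ x))) ×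
        padded x ≡ M
    complete {M} sn with pad-complete (M ⟨_,_⟩) sn
    ... | s , k , σ , h , sn-h , nz-h , _ , eq = (s , k , σ , h) , (sn-h , nz-h) ,
      table-ext λ i j → trans (at-padded σ h i j)
          (trans (sym (eq _ _)) (cong₂ (M ⟨_,_⟩) (place-side σ i) (place-side σ j)))

-- Sums over finite index sets

∑ : ∀ {n} → (Fin n → ℕ) → ℕ
∑ f = Vec.sum (tabulate f)

∑-cong : ∀ {n} {f g : Fin n → ℕ} → (∀ i → f i ≡ g i) → ∑ f ≡ ∑ g
∑-cong eq = cong Vec.sum (Vecₚ.tabulate-cong eq)

∑-+ : ∀ {n} (f g : Fin n → ℕ) → ∑ (λ i → f i + g i) ≡ ∑ f + ∑ g
∑-+ {zero}  f g = refl
∑-+ {suc n} f g = trans (cong (λ k → f zero + g zero + k) (∑-+ (f ∘ suc) (g ∘ suc)))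
  (interchange ℕₚ.+-commutativeSemigroup (f zero) (g zero) (∑ (f ∘ suc)) (∑ (g ∘ suc)))

∑-* : ∀ {n} c (f : Fin n → ℕ) → ∑ (λ i → c * f i) ≡ c * ∑ f
∑-* {zero}  c f = sym (ℕₚ.*-zeroʳ c)
∑-* {suc n} c f = trans (cong (λ k → c * f zero + k) (∑-* c (f ∘ suc))) (sym (ℕₚ.*-distribˡ-+ c (f zero) _))

∑-mono : ∀ {n} {f g : Fin n → ℕ} → (∀ i → f i ≤ g i) → ∑ f ≤ ∑ g
∑-mono {zero}  le = z≤n
∑-mono {suc n} le = ℕₚ.+-mono-≤ (le zero) (∑-mono (le ∘ suc))

∑-mono-< : ∀ {n} {f g : Fin n → ℕ} → (∀ i → f i ≤ g i) → ∀ j → f j < g j → ∑ f < ∑ g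
∑-mono-< le zero    lt = ℕₚ.+-mono-<-≤ lt (∑-mono (le ∘ suc))
∑-mono-< le (suc j) lt = ℕₚ.+-mono-≤-< (le zero) (∑-mono-< (le ∘ suc) j lt)

∑-balance : ∀ {n} (f g : Fin n → ℕ) → ∑ f ≡ ∑ g → ∀ j → f j < g j → ∃ λ j' → g j' < f j'
∑-balance f g eq j lt with Finₚ.any? (λ j' → g j' ℕ.<? f j')
... | yes found = found
... | no none   = ⊥-elim (ℕₚ.<⇒≢ (∑-mono-< (λ i → ℕₚ.≮⇒≥ λ gt → none (i , gt)) j lt) eq)

ind : {P : Set} → Dec P → ℕ
ind d = if does d then 1 else 0

ind-yes : {P : Set} (d : Dec P) → P → ind d ≡ 1
ind-yes (yes _) _ = refl
ind-yes (no ¬p) p = ⊥-elim (¬p p)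

ind-no : {P : Set} (d : Dec P) → ¬ P → ind d ≡ 0
ind-no (yes p) ¬p = ⊥-elim (¬p p)
ind-no (no _)  _  = refl

∑-zero : ∀ n → ∑ {n} (λ _ → 0) ≡ 0
∑-zero zero    = refl
∑-zero (suc n) = ∑-zero n

∑-ind : ∀ {n} (j : Fin n) → ∑ (λ i → ind (i Fin.≟ j)) ≡ 1
∑-ind {suc n} zero    = cong suc (∑-zero n)
∑-ind {suc n} (suc j) = ∑-ind j

-- Row and column sums

Vec-sum-∑ : ∀ {q n} (v : Vec (Fin q) n) → Vec.sum (Vec.map toℕ v) ≡ ∑ (toℕ ∘ lookup v)
Vec-sum-∑ []      = refl
Vec-sum-∑ (x ∷ v) = cong (λ k → toℕ x + k) (Vec-sum-∑ v)

lookup-rowSums : ∀ {m q n} (M : Vec (Vec (Fin q) n) m) i → lookup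
    (Vec.map (λ r → Vec.sum (Vec.map toℕ r)) M) i ≡ ∑ (λ j → toℕ (M ⟨ i , j ⟩))
lookup-rowSums M i = trans (Vecₚ.lookup-map i _ M) (Vec-sum-∑ (lookup M i))

lookup-transpose-∷ : ∀ {m n} (r : Vec A n) (M : Table A m n) j →
  lookup (Vec.transpose (r ∷ M)) j ≡ lookup r j ∷ lookup (Vec.transpose M) j
lookup-transpose-∷ r M j = trans (Vecₚ.lookup-⊛ j (Vec.replicate _ Vec._∷_ Vec.⊛ r) (Vec.transpose M))
  (cong (λ cons → cons (lookup (Vec.transpose M) j))
    (trans (Vecₚ.lookup-⊛ j (Vec.replicate _ Vec._∷_) r)
        (cong (λ cons → cons (lookup r j)) (Vecₚ.lookup-replicate j Vec._∷_))))

transpose-entry : ∀ {m n} (M : Table A m n) i j → Vec.transpose M ⟨ j , i ⟩ ≡ M ⟨ i , j ⟩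
transpose-entry (r ∷ M) zero    j = cong (λ v → lookup v zero) (lookup-transpose-∷ r M j)
transpose-entry (r ∷ M) (suc i) j =
  trans (cong (λ v → lookup v (suc i)) (lookup-transpose-∷ r M j)) (transpose-entry M i j)

SameSums : ∀ {q n} → Matrix q n → Matrix q n → Set
SameSums M M' = (∀ i → ∑ (λ j → toℕ (entry M i j)) ≡ ∑ (λ j → toℕ (entry M' i j)))
              × (∀ j → ∑ (λ i → toℕ (entry M i j)) ≡ ∑ (λ i → toℕ (entry M' i j)))

lookup-colSums : ∀ {q n} (M : Matrix q n) j → lookup (colSums M) j ≡ ∑ (λ i → toℕ (entry M i j))
lookup-colSums M j = trans (lookup-rowSums (Vec.transpose M) j)
    (∑-cong λ i → cong toℕ (transpose-entry M i j))

sums⇒SameSums : ∀ {q n} (M M' : Matrix q n) → rowSums M ≡ rowSums M' → colSums M ≡ colSums M' → SameSums M M'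
sums⇒SameSums M M' rows cols =
  (λ i → trans (sym (lookup-rowSums M i)) (trans (cong (λ v → lookup v i) rows) (lookup-rowSums M' i))) ,
  (λ j → trans (sym (lookup-colSums M j)) (trans (cong (λ v → lookup v j) cols) (lookup-colSums M' j)))

SameSums⇒sums : ∀ {q n} (M M' : Matrix q n) → SameSums M M' → rowSums M ≡ rowSums M' × colSums M ≡ colSums M'
SameSums⇒sums M M' (rows , cols) =
  vec-ext (λ i → trans (lookup-rowSums M i) (trans (rows i) (sym (lookup-rowSums M' i)))) ,
  vec-ext (λ j → trans (lookup-colSums M j) (trans (cols j) (sym (lookup-colSums M' j))))

-- Lonesum matrices

module _ {p : ℕ} where

  dec : Val p → Fin (suc (suc p))
  dec O       = zero
  dec (mid d) = suc (inject₁ d)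
  dec T       = suc (fromℕ p)

  enc : Fin (suc (suc p)) → Val p
  enc zero = O
  enc (suc i) with view i
  ... | ‵fromℕ     = T
  ... | ‵inject₁ d = mid d

  dec-enc : ∀ x → dec (enc x) ≡ x
  dec-enc zero = refl
  dec-enc (suc i) with view i
  ... | ‵fromℕ     = refl
  ... | ‵inject₁ d = refl

  dec-injective : ∀ {x y} → dec x ≡ dec y → x ≡ y
  dec-injective {O}     {O}     _  = refl
  dec-injective {T}     {T}     _  = refl
  dec-injective {T}     {mid d} eq = ⊥-elim (Finₚ.fromℕ≢inject₁ (Finₚ.suc-injective eq))
  dec-injective {mid d} {T}     eq = ⊥-elim (Finₚ.fromℕ≢inject₁ (sym (Finₚ.suc-injective eq)))
  dec-injective {mid d} {mid e} eq = cong mid (Finₚ.inject₁-injective (Finₚ.suc-injective eq))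

  num : Val p → ℕ
  num x = toℕ (dec x)

  pos⇒num : ∀ x → Pos x → 0 < num x
  pos⇒num T       _ = s≤s z≤n
  pos⇒num (mid _) _ = s≤s z≤n

  num⇒pos : ∀ x → 0 < num x → Pos x
  num⇒pos T       _ = tt
  num⇒pos (mid _) _ = tt

  low⇒num : ∀ x → Low x → num x < suc p
  low⇒num O       _ = s≤s z≤n
  low⇒num (mid d) _ = s≤s (Finₚ.inject₁ℕ< d)

  num⇒low : ∀ x → num x < suc p → Low x
  num⇒low O       _  = tt
  num⇒low (mid _) _  = tt
  num⇒low T       lt = ⊥-elim (ℕₚ.<⇒≢ lt (cong suc (Finₚ.toℕ-fromℕ p)))

  -- All mid values share a rank because their numerical order is not controlled along the walk: in
  -- a common column, a low entry may exceed a positive one numerically, but never in rank.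
  rank : Val p → ℕ
  rank O       = 0
  rank (mid _) = 1
  rank T       = 2

  rank≤2 : ∀ x → rank x ≤ 2
  rank≤2 O       = z≤n
  rank≤2 (mid _) = s≤s z≤n
  rank≤2 T       = s≤s (s≤s z≤n)

  low⇒rank : ∀ x → Low x → rank x ≤ 1
  low⇒rank O       _ = z≤n
  low⇒rank (mid _) _ = s≤s z≤n

  pos⇒rank : ∀ x → Pos x → 1 ≤ rank x
  pos⇒rank (mid _) _ = s≤s z≤n
  pos⇒rank T       _ = s≤s z≤n

  ¬pos⇒rank : ∀ x → ¬ Pos x → rank x ≡ 0
  ¬pos⇒rank x ¬pos = cong rank (¬pos⇒O ¬pos)

  decode : ∀ {n} → Square {p} n → Matrix (suc (suc p)) n
  decode N = table λ i j → dec (N ⟨ i , j ⟩)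

  entry-decode : ∀ {n} (N : Square {p} n) i j → entry (decode N) i j ≡ dec (N ⟨ i , j ⟩)
  entry-decode N = at-table _

  -- A switch-free matrix is determined by its sums

  module _ {n : ℕ} {N : Square {p} n} (ns : NoSwitch (N ⟨_,_⟩)) {b : Fin n → Fin n → ℕ}
      (b≤ : ∀ i j → b i j ≤ suc p)
    (rows : ∀ i → ∑ (λ j → num (N ⟨ i , j ⟩)) ≡ ∑ (b i))
    (cols : ∀ j → ∑ (λ i → num (N ⟨ i , j ⟩)) ≡ ∑ (λ i → b i j)) where

    Excess Deficit : Fin n → Fin n → Set
    Excess i j  = num (N ⟨ i , j ⟩) < b i j
    Deficit i j = b i j < num (N ⟨ i , j ⟩)

    excess⇒low : ∀ {i j} → Excess i j → Low (N ⟨ i , j ⟩)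
    excess⇒low {i} {j} e = num⇒low _ (ℕₚ.<-≤-trans e (b≤ i j))

    deficit⇒pos : ∀ {i j} → Deficit i j → Pos (N ⟨ i , j ⟩)
    deficit⇒pos d = num⇒pos _ (ℕₚ.≤-<-trans z≤n d)

    row-excess : ∀ {i j} → Deficit i j → ∃ (Excess i)
    row-excess {i} {j} = ∑-balance (b i) _ (sym (rows i)) j

    column-deficit : ∀ {i j} → Excess i j → ∃ λ i' → Deficit i' j
    column-deficit {i} {j} = ∑-balance _ (λ i → b i j) (cols j) i

    potential : Fin n → ℕ
    potential i = ∑ (λ j → rank (N ⟨ i , j ⟩))

    distinct : ∀ {i i' j} → Deficit i j → Excess i' j → i ≢ i'
    distinct d e refl = ℕₚ.<-asym d e

    no-cross : ∀ {i i' j j'} → Deficit i' j → Excess i j → j ≢ j' → Pos (N ⟨ i , j' ⟩) → ¬ Low (N ⟨ i' , j' ⟩)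
    no-cross d e j≢j' pos low = ns _ _ _ _ (distinct d e) j≢j' (deficit⇒pos d) pos low (excess⇒low e)

    -- In column j a low entry, of rank at most 1, faces a positive one, of rank at least 1. In any
    -- other column where row i is positive, the absence of switches forces `T` in row i'.
    rank-≤ : ∀ {i i' j} → Deficit i' j → Excess i j → ∀ j' → rank (N ⟨ i , j' ⟩) ≤ rank (N ⟨ i' , j' ⟩)
    rank-≤ {i} {i'} {j} d e j' with j Fin.≟ j' | pos? (N ⟨ i , j' ⟩)
    ... | yes refl | _ = ℕₚ.≤-trans (low⇒rank _ (excess⇒low e)) (pos⇒rank _ (deficit⇒pos d))
    ... | no _     | no ¬pos = subst (_≤ _) (sym (¬pos⇒rank _ ¬pos)) z≤n
    ... | no j≢j'  | yes pos = subst (λ x → _ ≤ rank x) (sym (¬low⇒T (no-cross d e j≢j' pos))) (rank≤2 _)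

    climb : ∀ {i j} → Excess i j → ∃₂ λ i' j' → Excess i' j' × potential i < potential i'
    climb {i} {j} e with i₂ , d₂ ← column-deficit e with j₂ , e₂ ← row-excess d₂ with pos? (N ⟨ i₂ , j₂ ⟩)
    -- The excess makes `(i₂ , j₂)` low, so `no-cross` forces a zero at `(i , j₂)`: the rank rises
    -- strictly in column `j₂`.
    ... | yes pos = i₂ , j₂ , e₂ , ∑-mono-< (rank-≤ d₂ e) j₂
      (subst (_< _) (sym (¬pos⇒rank _ λ pos' → no-cross d₂ e (λ { refl → ℕₚ.<-asym d₂ e₂ }) pos'
          (excess⇒low e₂))) (pos⇒rank _ pos))
    -- A zero at `(i₂ , j₂)` shows no gain yet, but one more round does: the deficit at `(i₃ , j₂)`
    -- makes that entry positive.
    ... | no ¬pos with i₃ , d₃ ← column-deficit e₂ with j₃ , e₃ ← row-excess d₃ =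
      i₃ , j₃ , e₃ , ℕₚ.≤-<-trans (∑-mono (rank-≤ d₂ e))
        (∑-mono-< (rank-≤ d₃ e₂) j₂ (subst (_< _) (sym (¬pos⇒rank _ ¬pos)) (pos⇒rank _ (deficit⇒pos d₃))))

    -- Ranks are at most 2, so the potential is capped by twice n, and k bounds the climbs still
    -- possible.
    no-excess-within : ∀ k {i j} → Excess i j → ¬ (∑ {n} (λ _ → 2) < potential i + k)
    no-excess-within zero    {i} e lt =
        ℕₚ.<⇒≱ lt (subst (_≤ _) (sym (ℕₚ.+-identityʳ (potential i))) (∑-mono (λ j → rank≤2 (N ⟨ i , j ⟩))))
    no-excess-within (suc k) {i} e lt with _ , _ , e' , up ← climb e =
      no-excess-within k e' (ℕₚ.<-≤-trans lt
          (ℕₚ.≤-trans (ℕₚ.≤-reflexive (ℕₚ.+-suc (potential i) k)) (ℕₚ.+-monoˡ-≤ k up)))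

    no-excess : ∀ i j → ¬ Excess i j
    no-excess i j e = no-excess-within (suc (∑ {n} (λ _ → 2))) e (ℕₚ.m≤n+m _ (potential i))

    determined : ∀ i j → b i j ≡ num (N ⟨ i , j ⟩)
    -- A deficit needs no separate walk: its row would contain an excess.
    determined i j = ℕₚ.≤-antisym (ℕₚ.≮⇒≥ (no-excess i j)) (ℕₚ.≮⇒≥ λ d → no-excess i _ (proj₂ (row-excess d)))

  NoSwitch⇒lonesum : ∀ {n} (N : Square {p} n) → NoSwitch (N ⟨_,_⟩) → IsLonesum (decode N)
  NoSwitch⇒lonesum N ns M' row-eq col-eq = table-ext λ i j → Finₚ.toℕ-injective
    (trans (determined {N = N} ns {λ i j → toℕ (entry M' i j)} (λ i j → ℕₚ.≤-pred (Finₚ.toℕ<n (entry M' i j)))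
      (λ i → trans (∑-cong λ j → sym (entry-num i j)) (proj₁ same-sums i))
      (λ j → trans (∑-cong λ i → sym (entry-num i j)) (proj₂ same-sums j)) i j) (sym (entry-num i j)))
    where
    entry-num : ∀ i j → toℕ (entry (decode N) i j) ≡ num (N ⟨ i , j ⟩)
    entry-num i j = cong toℕ (entry-decode N i j)
    same-sums = sums⇒SameSums (decode N) M' (sym row-eq) (sym col-eq)

  -- A switch yields a second matrix with the same sums

  module _ {n : ℕ} (N : Square {p} n) {i i' j j' : Fin n} (i≢i' : i ≢ i') (j≢j' : j ≢ j')
    (p₁ : Pos (N ⟨ i , j ⟩)) (p₂ : Pos (N ⟨ i' , j' ⟩)) (l₁ : Low (N ⟨ i , j' ⟩))
        (l₂ : Low (N ⟨ i' , j ⟩)) where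

    private
      -- The exchanged units are added back, on both sides, so that no subtraction occurs.
      Exchange : (x y : Fin n) → Dec (x ≡ i) → Dec (x ≡ i') → Dec (y ≡ j) → Dec (y ≡ j') → Fin (suc (suc p)) →
          Set
      Exchange x y x=i x=i' y=j y=j' v =
        toℕ v + (ind x=i * ind y=j + ind x=i' * ind y=j') ≡ num (N ⟨ x , y ⟩) +
            (ind x=i * ind y=j' + ind x=i' * ind y=j)

      down : ∀ x → Pos x → ∃ λ v → toℕ v + 1 ≡ num x + 0
      down x pos with dec x | pos⇒num x pos
      ... | suc v | _ = inject₁ v , trans (ℕₚ.+-comm _ 1)
          (trans (cong suc (Finₚ.toℕ-inject₁ v)) (sym (ℕₚ.+-identityʳ _)))

      up : ∀ x → Low x → ∃ λ v → toℕ v + 0 ≡ num x + 1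
      up x low = Fin.fromℕ< (s≤s (low⇒num x low)) , trans (ℕₚ.+-identityʳ _)
          (trans (Finₚ.toℕ-fromℕ< (s≤s (low⇒num x low))) (ℕₚ.+-comm 1 _))

      exchange : ∀ x y x=i x=i' y=j y=j' → ∃ (Exchange x y x=i x=i' y=j y=j')
      exchange x y (yes refl) (yes eq)   _          _          = ⊥-elim (i≢i' eq)
      exchange x y _          _          (yes refl) (yes eq)   = ⊥-elim (j≢j' eq)
      exchange x y (yes refl) (no _)     (yes refl) (no _)     = down _ p₁
      exchange x y (yes refl) (no _)     (no _)     (yes refl) = up _ l₁
      exchange x y (no _)     (yes refl) (yes refl) (no _)     = up _ l₂
      exchange x y (no _)     (yes refl) (no _)     (yes refl) = down _ p₂
      exchange x y (yes refl) (no _)     (no _)     (no _)     = _ , refl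
      exchange x y (no _)     (yes refl) (no _)     (no _)     = _ , refl
      exchange x y (no _)     (no _)     (yes _)    (no _)     = _ , refl
      exchange x y (no _)     (no _)     (no _)     (yes _)    = _ , refl
      exchange x y (no _)     (no _)     (no _)     (no _)     = _ , refl

      new : ∀ x y → ∃ (Exchange x y (x Fin.≟ i) (x Fin.≟ i') (y Fin.≟ j) (y Fin.≟ j'))
      new x y = exchange x y (x Fin.≟ i) (x Fin.≟ i') (y Fin.≟ j) (y Fin.≟ j')

      M' : Matrix (suc (suc p)) n
      M' = table λ x y → proj₁ (new x y)

      δ : Fin n → Fin n → ℕ
      δ x a = ind (x Fin.≟ a)

      relation : ∀ x y → toℕ (entry M' x y) + (δ x i * δ y j + δ x i' * δ y j')
                       ≡ toℕ (entry (decode N) x y) + (δ x i * δ y j' + δ x i' * δ y j)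
      relation x y = trans (cong (λ v → toℕ v + (δ x i * δ y j + δ x i' * δ y j'))
          (at-table (λ x y → proj₁ (new x y)) x y))
        (trans (proj₂ (new x y)) (cong (λ v → toℕ v + (δ x i * δ y j' + δ x i' * δ y j))
            (sym (entry-decode N x y))))

      -- Along a line each correction is concentrated at one position, so its total does not depend
      -- on where it sits. Only the equality `c + c' ≡ d + d'` matters, and this serves rows and
      -- columns alike.
      ∑-cancel : ∀ (f g : Fin n → ℕ) (c c' : ℕ) (k k' : Fin n) (d d' : ℕ) (l l' : Fin n) → c + c' ≡ d + d' →
        (∀ y → f y + (c * δ y k + c' * δ y k') ≡ g y + (d * δ y l + d' * δ y l')) → ∑ f ≡ ∑ g
      ∑-cancel f g c c' k k' d d' l l' c+c' eq = ℕₚ.+-cancelʳ-≡ (c + c') (∑ f) (∑ g)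
        (trans (sym (total f c c' k k'))
            (trans (∑-cong eq) (trans (total g d d' l l') (cong (λ k → ∑ g + k) (sym c+c')))))
        where
        scaled : ∀ c k → ∑ (λ y → c * δ y k) ≡ c
        scaled c k = trans (∑-* c (λ y → δ y k)) (trans (cong (c *_) (∑-ind k)) (ℕₚ.*-identityʳ c))
        total : ∀ (f : Fin n → ℕ) c c' k k' → ∑ (λ y → f y + (c * δ y k + c' * δ y k')) ≡ ∑ f + (c + c')
        total f c c' k k' = trans (∑-+ f _)
            (cong (λ k → ∑ f + k) (trans (∑-+ (λ y → c * δ y k) (λ y → c' * δ y k'))
              (cong₂ _+_ (scaled c k) (scaled c' k'))))

      same-sums : SameSums M' (decode N)
      same-sums =
        (λ x → ∑-cancel _ _ (δ x i) (δ x i') j j' (δ x i) (δ x i') j' j refl (relation x)) ,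
        (λ y → ∑-cancel _ _ (δ y j) (δ y j') i i' (δ y j') (δ y j) i i' (ℕₚ.+-comm (δ y j) _)
          λ x → trans (cong (λ k → toℕ (entry M' x y) + k) (swap x y j j')) (trans (relation x y)
                (cong (λ k → toℕ (entry (decode N) x y) + k) (sym (swap x y j' j)))))
        where
        swap : ∀ x y j j' → δ y j * δ x i + δ y j' * δ x i' ≡ δ x i * δ y j + δ x i' * δ y j'
        swap x y j j' = cong₂ _+_ (ℕₚ.*-comm (δ y j) _) (ℕₚ.*-comm (δ y j') _)

    -- At `(i , j)` the correction is 1 on the side of the new matrix and 0 on the other, so the two
    -- matrices differ there.
    switch⇒¬lonesum : ¬ IsLonesum (decode N)
    switch⇒¬lonesum lonesum = unbalanced (ℕₚ.+-cancelˡ-≡ (toℕ (entry (decode N) i j)) _ _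
      (subst (λ M → toℕ (entry M i j) + (δ i i * δ j j + δ i i' * δ j j') ≡ toℕ (entry (decode N) i j) +
          (δ i i * δ j j' + δ i i' * δ j j))
        (lonesum M' (proj₁ sums) (proj₂ sums)) (relation i j)))
      where
      sums = SameSums⇒sums M' (decode N) same-sums
      unbalanced : δ i i * δ j j + δ i i' * δ j j' ≢ δ i i * δ j j' + δ i i' * δ j j
      unbalanced eq rewrite ind-yes (i Fin.≟ i) refl | ind-yes (j Fin.≟ j) refl
        | ind-no (i Fin.≟ i') i≢i' | ind-no (j Fin.≟ j') j≢j' with () ← eq

  decode-injective : ∀ {n} {N N' : Square {p} n} → decode N ≡ decode N' → N ≡ N'
  decode-injective {N = N} {N'} eq = table-ext λ i j → dec-injective
    (trans (sym (entry-decode N i j)) (trans (cong (λ M → entry M i j) eq) (entry-decode N' i j)))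

  SN⇒symmetric-lonesum : ∀ {n} (N : Square {p} n) → SN (N ⟨_,_⟩) → IsSymmetric (decode N) × IsLonesum
      (decode N)
  SN⇒symmetric-lonesum N (sy , ns) =
    (λ i j → trans (entry-decode N i j) (trans (cong dec (sy i j)) (sym (entry-decode N j i)))) ,
    NoSwitch⇒lonesum N ns

  symmetric-lonesum⇒SN : ∀ {n} (N : Square {p} n) → IsSymmetric (decode N) → IsLonesum (decode N) → SN
      (N ⟨_,_⟩)
  symmetric-lonesum⇒SN N sy lonesum =
    (λ i j → dec-injective (trans (sym (entry-decode N i j)) (trans (sy i j) (entry-decode N j i)))) ,
    λ i i' j j' i≢i' j≢j' p₁ p₂ l₁ l₂ → switch⇒¬lonesum N i≢i' j≢j' p₁ p₂ l₁ l₂ lonesum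

  count-symmetric-lonesum : ∀ n → CountIs (λ (M : Matrix (suc (suc p)) n) → IsSymmetric M × IsLonesum M)
    (splittings n n λ _ k → coreCount p n n k)
  count-symmetric-lonesum n =
      count-image decode (count-SN n) (λ _ _ → decode-injective) (λ {N} → SN⇒symmetric-lonesum N) complete
    where
    complete : ∀ {M : Matrix (suc (suc p)) n} → IsSymmetric M × IsLonesum M → ∃ λ N → SN (N ⟨_,_⟩) ×
        decode N ≡ M
    complete {M} (sy , lonesum) =
        N , symmetric-lonesum⇒SN N (subst IsSymmetric (sym eq) sy) (subst IsLonesum (sym eq) lonesum) , eq
      where
      N : Square {p} n
      N = table λ i j → enc (entry M i j)
      eq : decode N ≡ M
      eq = table-ext λ i j → trans (entry-decode N i j) (trans (cong dec (at-table _ i j)) (dec-enc _))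

-- Integer sums

∑ℤ : (A → ℤ) → List A → ℤ
∑ℤ g xs = sumℤ (map g xs)

∑ℤ-cong : {g h : A → ℤ} → (∀ x → g x ≡ h x) → ∀ xs → ∑ℤ g xs ≡ ∑ℤ h xs
∑ℤ-cong eq xs = cong sumℤ (Listₚ.map-cong eq xs)

∑ℤ-++ : (g : A → ℤ) → ∀ xs ys → ∑ℤ g (xs ++ ys) ≡ ∑ℤ g xs ℤ.+ ∑ℤ g ys
∑ℤ-++ g []       ys = sym (ℤₚ.+-identityˡ _)
∑ℤ-++ g (x ∷ xs) ys = trans (cong (λ z → g x ℤ.+ z) (∑ℤ-++ g xs ys)) (sym (ℤₚ.+-assoc (g x) _ _))

∑ℤ-concatMap : (g : B → ℤ) (F : A → List B) → ∀ xs → ∑ℤ g (concatMap F xs) ≡ ∑ℤ (λ x → ∑ℤ g (F x)) xs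
∑ℤ-concatMap g F []       = refl
∑ℤ-concatMap g F (x ∷ xs) = trans (∑ℤ-++ g (F x) _) (cong (λ z → ∑ℤ g (F x) ℤ.+ z) (∑ℤ-concatMap g F xs))

∑ℤ-* : ∀ c (g : A → ℤ) xs → ∑ℤ (λ x → c ℤ.* g x) xs ≡ c ℤ.* ∑ℤ g xs
∑ℤ-* c g []       = sym (ℤₚ.*-zeroʳ c)
∑ℤ-* c g (x ∷ xs) = trans (cong (λ z → c ℤ.* g x ℤ.+ z) (∑ℤ-* c g xs)) (sym (ℤₚ.*-distribˡ-+ c (g x) _))

∑ℤ-+ : (g h : A → ℤ) → ∀ xs → ∑ℤ (λ x → g x ℤ.+ h x) xs ≡ ∑ℤ g xs ℤ.+ ∑ℤ h xs
∑ℤ-+ g h []       = refl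
∑ℤ-+ g h (x ∷ xs) = trans (cong (λ z → g x ℤ.+ h x ℤ.+ z) (∑ℤ-+ g h xs))
    (interchange ℤₚ.+-commutativeSemigroup (g x) (h x) (∑ℤ g xs) (∑ℤ h xs))

∑ℤ-0 : (xs : List A) → ∑ℤ (λ _ → + 0) xs ≡ + 0
∑ℤ-0 []       = refl
∑ℤ-0 (x ∷ xs) = trans (ℤₚ.+-identityˡ _) (∑ℤ-0 xs)

∑ℤ-pos : (c : A → ℕ) → ∀ xs → + sum (map c xs) ≡ ∑ℤ (λ x → + c x) xs
∑ℤ-pos c []       = refl
∑ℤ-pos c (x ∷ xs) = cong (λ z → + c x ℤ.+ z) (∑ℤ-pos c xs)

∑ℤ-single : (g : A → ℤ) {xs : List A} {a : A} → Unique xs → a ∈ xs → (∀ x → x ≢ a → g x ≡ + 0) → ∑ℤ g xs ≡ g a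
∑ℤ-single g {x ∷ xs} (x∉ ∷ u) (here refl) zeros =
  trans (cong (λ z → g x ℤ.+ z) (vanish xs x∉)) (ℤₚ.+-identityʳ (g x))
  where
  vanish : ∀ ys → All (x ≢_) ys → ∑ℤ g ys ≡ + 0
  vanish []       []       = refl
  vanish (y ∷ ys) (x≢y ∷ x∉) = cong₂ ℤ._+_ (zeros y (x≢y ∘ sym)) (vanish ys x∉)
∑ℤ-single g {x ∷ xs} (x∉ ∷ u) (there a∈) zeros =
  trans (cong₂ ℤ._+_ (zeros x (All.lookup x∉ a∈)) (∑ℤ-single g u a∈ zeros)) (ℤₚ.+-identityˡ _)

-- Replacing a filter by zero summands leaves a sum over all tuples, from which one coordinate at a
-- time can be split off.
guard : {P : Set} → Dec P → ℤ → ℤ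
guard d z = if does d then z else + 0

guard-yes : {P : Set} (d : Dec P) {z : ℤ} → P → guard d z ≡ z
guard-yes (yes _) _ = refl
guard-yes (no ¬p) p = ⊥-elim (¬p p)

guard-no : {P : Set} (d : Dec P) {z : ℤ} → ¬ P → guard d z ≡ + 0
guard-no (yes p) ¬p = ⊥-elim (¬p p)
guard-no (no _)  _  = refl

guard-cong : {P : Set} (d : Dec P) {z w : ℤ} → (P → z ≡ w) → guard d z ≡ guard d w
guard-cong (yes p) eq = eq p
guard-cong (no _)  _  = refl

guard-×ʳ : {P Q : Set} (d : Dec P) (e : Dec Q) {z : ℤ} → P → guard (d ×-dec e) z ≡ guard e z
guard-×ʳ (yes _) e p = refl
guard-×ʳ (no ¬p) e p = ⊥-elim (¬p p)

guard-* : {P : Set} (d : Dec P) (c z : ℤ) → guard d (c ℤ.* z) ≡ c ℤ.* guard d z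
guard-* (yes _) c z = refl
guard-* (no _)  c z = sym (ℤₚ.*-zeroʳ c)

∑ℤ-filter : {P : A → Set} (P? : ∀ x → Dec (P x)) (g : A → ℤ) → ∀ xs →
  ∑ℤ g (filter P? xs) ≡ ∑ℤ (λ x → guard (P? x) (g x)) xs
∑ℤ-filter P? g []       = refl
∑ℤ-filter P? g (x ∷ xs) with does (P? x)
... | true  = cong (λ z → g x ℤ.+ z) (∑ℤ-filter P? g xs)
... | false = trans (∑ℤ-filter P? g xs) (sym (ℤₚ.+-identityˡ _))

∑ℤ-tuples : ∀ k l (g : List ℕ → ℤ) →
  ∑ℤ g (tuples (suc k) l) ≡ ∑ℤ (λ x → ∑ℤ (g ∘ (x ∷_)) (tuples k l)) (upTo (suc l))
∑ℤ-tuples k l g = trans (∑ℤ-concatMap g (λ x → map (x ∷_) (tuples k l)) (upTo (suc l)))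
  (∑ℤ-cong (λ x → cong sumℤ (sym (Listₚ.map-∘ (tuples k l)))) (upTo (suc l)))

∑ℤ-tuples-cong : ∀ k l {g h : List ℕ → ℤ} → (∀ ns → length ns ≡ k → g ns ≡ h ns) →
  ∑ℤ g (tuples k l) ≡ ∑ℤ h (tuples k l)
∑ℤ-tuples-cong zero    l eq = cong (λ z → z ℤ.+ + 0) (eq [] refl)
∑ℤ-tuples-cong (suc k) l {g} {h} eq = trans (∑ℤ-tuples k l g)
  (trans (∑ℤ-cong (λ x → ∑ℤ-tuples-cong k l λ ns len → eq (x ∷ ns) (cong suc len)) (upTo (suc l)))
         (sym (∑ℤ-tuples k l h)))

sumTo : (ℕ → ℤ) → ℕ → ℤ
sumTo e zero    = e 0
sumTo e (suc J) = e 0 ℤ.+ sumTo (e ∘ suc) J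

sumTo-cong : ∀ {e e' : ℕ → ℤ} → (∀ j → e j ≡ e' j) → ∀ J → sumTo e J ≡ sumTo e' J
sumTo-cong eq zero    = eq 0
sumTo-cong eq (suc J) = cong₂ ℤ._+_ (eq 0) (sumTo-cong (eq ∘ suc) J)

sumTo-* : ∀ c e J → sumTo (λ j → c ℤ.* e j) J ≡ c ℤ.* sumTo e J
sumTo-* c e zero    = refl
sumTo-* c e (suc J) = trans (cong (λ z → c ℤ.* e 0 ℤ.+ z) (sumTo-* c (e ∘ suc) J))
    (sym (ℤₚ.*-distribˡ-+ c (e 0) _))

sumTo-∑ℤ : ∀ (g : ℕ → A → ℤ) xs J → sumTo (λ j → ∑ℤ (g j) xs) J ≡ ∑ℤ (λ x → sumTo (λ j → g j x) J) xs
sumTo-∑ℤ g xs zero    = refl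
sumTo-∑ℤ g xs (suc J) = trans (cong (λ z → ∑ℤ (g 0) xs ℤ.+ z) (sumTo-∑ℤ (g ∘ suc) xs J))
    (sym (∑ℤ-+ (g 0) _ xs))

sumℤ-applyUpTo : ∀ e n → sumℤ (applyUpTo e (suc n)) ≡ sumTo e n
sumℤ-applyUpTo e zero    = ℤₚ.+-identityʳ (e 0)
sumℤ-applyUpTo e (suc n) = cong (λ z → e 0 ℤ.+ z) (sumℤ-applyUpTo (e ∘ suc) n)

-- Splittings with integer weights

splittingsℤ : ℕ → ℕ → (ℕ → ℕ → ℤ) → ℤ
splittingsℤ N n c = ∑ℤ (λ a → + (n C a) ℤ.* c a (n ∸ a)) (upTo (suc N))

splittingsℤ-pos : ∀ N n c → + splittings N n c ≡ splittingsℤ N n (λ a b → + c a b)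
splittingsℤ-pos N n c = trans (∑ℤ-pos (λ a → (n C a) * c a (n ∸ a)) (upTo (suc N)))
  (∑ℤ-cong (λ a → ℤₚ.pos-* (n C a) _) (upTo (suc N)))

-- The binomial coefficient vanishes for a > n, which is where `n ∸ a` is truncated.
C-cong : ∀ n a {z w : ℤ} → (a ≤ n → z ≡ w) → + (n C a) ℤ.* z ≡ + (n C a) ℤ.* w
C-cong n a eq with a ℕ.≤? n
... | yes a≤n = cong (+ (n C a) ℤ.*_) (eq a≤n)
... | no a≰n rewrite k>n⇒nCk≡0 (ℕₚ.≰⇒> a≰n) = refl

splittingsℤ-cong : ∀ N n {c c' : ℕ → ℕ → ℤ} → (∀ a b → a + b ≡ n → c a b ≡ c' a b) →
    splittingsℤ N n c ≡ splittingsℤ N n c'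
splittingsℤ-cong N n eq = ∑ℤ-cong (λ a → C-cong n a λ a≤n → eq a (n ∸ a) (ℕₚ.m+[n∸m]≡n a≤n)) (upTo (suc N))

splittingsℤ-sumTo : ∀ N n J (c : ℕ → ℕ → ℕ → ℤ) →
  sumTo (λ j → splittingsℤ N n (c j)) J ≡ splittingsℤ N n (λ a b → sumTo (λ j → c j a b) J)
splittingsℤ-sumTo N n J c = trans (sumTo-∑ℤ (λ j a → + (n C a) ℤ.* c j a (n ∸ a)) (upTo (suc N)) J)
  (∑ℤ-cong (λ a → sumTo-* (+ (n C a)) (λ j → c j a (n ∸ a)) J) (upTo (suc N)))

splittingsℤ-all : ∀ {N n} → n ≤ N → (c : ℕ → ℤ) → splittingsℤ N n (λ a b → guard (0 ℕ.≟ b) (c a)) ≡ c n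
splittingsℤ-all {N} {n} n≤N c = trans
  (∑ℤ-single _ (Uniqueₚ.upTo⁺ (suc N)) (∈-upTo⁺ (s≤s n≤N)) zeros)
  (trans (cong₂ (λ k z → + k ℤ.* z) (nCn≡1 n) (guard-yes (0 ℕ.≟ n ∸ n) (sym (ℕₚ.n∸n≡0 n))))
      (ℤₚ.*-identityˡ (c n)))
  where
  zeros : ∀ a → a ≢ n → + (n C a) ℤ.* guard (0 ℕ.≟ n ∸ a) (c a) ≡ + 0
  zeros a a≢n = trans (C-cong n a λ a≤n → guard-no (0 ℕ.≟ n ∸ a)
      λ 0≡ → a≢n (ℕₚ.≤-antisym a≤n (ℕₚ.m∸n≡0⇒m≤n (sym 0≡))))
    (ℤₚ.*-zeroʳ (+ (n C a)))

-- The sum of the theorem as a recursion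

positive : List ℕ → Set
positive = All (1 ≤_)

positive? : ∀ ns → Dec (positive ns)
positive? = all? (1 ℕ.≤?_)

-- The part of the formula belonging to `(n₁ , … , n_j)`, whose entries are positive with sum m. The
-- entry n₀ may vanish and is split off separately, in `level`.
compositions : ℕ → (List ℕ → ℤ) → ℕ → ℕ → ℤ
compositions N w j m = ∑ℤ (λ ns → guard ((sum ns ℕ.≟ m) ×-dec positive? ns) (+ multinomial ns ℤ.* w ns))
    (tuples j N)

-- Where the sum is m, the leading binomial of the multinomial coefficient is `m C x`. Otherwise
-- both sides vanish: for x ≤ m by their guards, for x > m because of the binomial coefficient.
peel : ∀ {P : Set} (d : Dec P) m x ns z →
  guard ((x + sum ns ℕ.≟ m) ×-dec d) (+ multinomial (x ∷ ns) ℤ.* z)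
  ≡ + (m C x) ℤ.* guard ((sum ns ℕ.≟ m ∸ x) ×-dec d) (+ multinomial ns ℤ.* z)
peel d m x ns z = by-cases (x + sum ns ℕ.≟ m)
  where
  by-cases : Dec (x + sum ns ≡ m) → guard ((x + sum ns ℕ.≟ m) ×-dec d) (+ multinomial (x ∷ ns) ℤ.* z)
    ≡ + (m C x) ℤ.* guard ((sum ns ℕ.≟ m ∸ x) ×-dec d) (+ multinomial ns ℤ.* z)
  by-cases (no ≢m) = trans (guard-no ((x + sum ns ℕ.≟ m) ×-dec d) (≢m ∘ proj₁))
    (sym (trans (C-cong m x λ x≤m → guard-no ((sum ns ℕ.≟ m ∸ x) ×-dec d)
        λ (eq , _) → ≢m (trans (cong (λ k → x + k) eq) (ℕₚ.m+[n∸m]≡n x≤m))) (ℤₚ.*-zeroʳ (+ (m C x)))))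
  by-cases (yes refl) = trans (guard-×ʳ (x + sum ns ℕ.≟ m) d refl)
    (trans (guard-cong d λ _ → trans (cong (ℤ._* z) (ℤₚ.pos-* (m C x) (multinomial ns)))
        (ℤₚ.*-assoc (+ (m C x)) _ z))
    (trans (guard-* d (+ (m C x)) _)
    (cong (+ (m C x) ℤ.*_) (sym (guard-×ʳ (sum ns ℕ.≟ m ∸ x) d (sym (ℕₚ.m+n∸m≡n x (sum ns))))))))

ifPositive : ℕ → ℤ → ℤ
ifPositive zero    _ = + 0
ifPositive (suc _) z = z

compositions-suc : ∀ N w j m →
  compositions N w (suc j) m ≡ splittingsℤ N m (λ x k → ifPositive x (compositions N (w ∘ (x ∷_)) j k))
compositions-suc N w j m = trans (∑ℤ-tuples j N _) (∑ℤ-cong step (upTo (suc N)))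
  where
  step : ∀ x → ∑ℤ (λ ns → guard ((x + sum ns ℕ.≟ m) ×-dec positive? (x ∷ ns))
      (+ multinomial (x ∷ ns) ℤ.* w (x ∷ ns))) (tuples j N)
    ≡ + (m C x) ℤ.* ifPositive x (compositions N (w ∘ (x ∷_)) j (m ∸ x))
  step zero = trans (∑ℤ-cong (λ ns → guard-no ((sum ns ℕ.≟ m) ×-dec positive? (0 ∷ ns)) λ { (_ , () ∷ _) })
      (tuples j N))
    (trans (∑ℤ-0 (tuples j N)) (sym (ℤₚ.*-zeroʳ (+ (m C 0)))))
  step x@(suc _) = trans (∑ℤ-cong (λ ns → peel (positive? ns) m x ns (w (x ∷ ns))) (tuples j N))
    (∑ℤ-* (+ (m C x)) _ (tuples j N))

compositions-* : ∀ N c w j m → compositions N (λ ns → c ℤ.* w ns) j m ≡ c ℤ.* compositions N w j m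
compositions-* N c w j m = trans (∑ℤ-cong (λ ns → trans
    (cong (guard ((sum ns ℕ.≟ m) ×-dec positive? ns)) (exchange (+ multinomial ns) c (w ns)))
    (guard-* ((sum ns ℕ.≟ m) ×-dec positive? ns) c _)) (tuples j N))
  (∑ℤ-* c _ (tuples j N))
  where
  exchange : ∀ a b c → a ℤ.* (b ℤ.* c) ≡ b ℤ.* (a ℤ.* c)
  exchange = solve-∀

compositions-0 : ∀ N w m → compositions N w 0 m ≡ guard (0 ℕ.≟ m) (w [])
compositions-0 N w zero    = trans (ℤₚ.+-identityʳ _) (ℤₚ.*-identityˡ (w []))
compositions-0 N w (suc m) = refl

pos-^ : ∀ m n → + (m ^ n) ≡ (+ m) ℤ.^ n
pos-^ m zero    = refl
pos-^ m (suc n) = trans (ℤₚ.pos-* m (m ^ n)) (cong (+ m ℤ.*_) (pos-^ m n))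

double-suc : ∀ i → 2 * suc i ≡ suc (suc (2 * i))
double-suc i = cong suc (ℕₚ.+-suc i (i + 0))

applyUpTo-cong : ∀ {g h : ℕ → A} → (∀ i → g i ≡ h i) → ∀ n → applyUpTo g n ≡ applyUpTo h n
applyUpTo-cong eq zero    = refl
applyUpTo-cong eq (suc n) = cong₂ _∷_ (eq 0) (applyUpTo-cong (eq ∘ suc) n)

half-suc-suc : ∀ j → suc (suc j) / 2 ≡ suc (j / 2)
half-suc-suc j = m/n≡1+[m∸n]/n {suc (suc j)} {2} (s≤s (s≤s z≤n))

module _ (p : ℕ) where

  private
    q : ℕ
    q = suc (suc p)

  -- The product and the last factor of the formula, read two entries at a time. An odd list leaves
  -- its last entry for that factor; an even one leaves 0, and the factor is 1.
  body : List ℕ → ℤ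
  body []           = + 1
  body (x ∷ [])     = + 1 ℤ.+ + p ℤ.* + x
  body (r ∷ s ∷ ns) = f q r s ℤ.* body ns

  compositions-1 : ∀ {N m} → m ≤ N → compositions N body 1 m ≡ ifPositive m (+ 1 ℤ.+ + p ℤ.* + m)
  compositions-1 {N} {m} m≤N = trans (compositions-suc N body 0 m)
    (trans (splittingsℤ-cong N m {c' =
        λ x k → guard (0 ℕ.≟ k) (ifPositive x (+ 1 ℤ.+ + p ℤ.* + x))} λ x k _ → trans
          (cong (ifPositive x) (compositions-0 N (body ∘ (x ∷_)) k)) (push x k {+ 1 ℤ.+ + p ℤ.* + x}))
      (splittingsℤ-all m≤N λ x → ifPositive x (+ 1 ℤ.+ + p ℤ.* + x)))
    where
    push : ∀ x k {z} → ifPositive x (guard (0 ℕ.≟ k) z) ≡ guard (0 ℕ.≟ k) (ifPositive x z)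
    push (suc _) k = refl
    push zero    zero    = refl
    push zero    (suc _) = refl

  cornerℤ : ℕ → ℕ → ℤ
  cornerℤ r s = ifPositive r (ifPositive s (f q r s))

  compositions-suc-suc : ∀ N j m → compositions N body (suc (suc j)) m
    ≡ splittingsℤ N m λ r m' → splittingsℤ N m' λ s k → cornerℤ r s ℤ.* compositions N body j k
  compositions-suc-suc N j m =
      trans (compositions-suc N body (suc j) m) (splittingsℤ-cong N m λ r m' _ → outer r m')
    where
    outer : ∀ r m' → ifPositive r (compositions N (body ∘ (r ∷_)) (suc j) m')
      ≡ splittingsℤ N m' λ s k → cornerℤ r s ℤ.* compositions N body j k
    outer zero m' = sym (trans (∑ℤ-cong (λ s → ℤₚ.*-zeroʳ (+ (m' C s))) (upTo (suc N))) (∑ℤ-0 (upTo (suc N))))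
    outer r@(suc _) m' = trans (compositions-suc N (body ∘ (r ∷_)) j m')
        (splittingsℤ-cong N m' λ s k _ → inner s k)
      where
      inner : ∀ s k → ifPositive s
          (compositions N (body ∘ (r ∷_) ∘ (s ∷_)) j k) ≡ cornerℤ r s ℤ.* compositions N body j k
      inner zero      k = refl
      inner s@(suc _) k = compositions-* N (f q r s) body j k

  -- Corner counts

  heavy-0 : ∀ n → heavy {p} 0 n ≡ suc p ^ n
  heavy-0 zero    = refl
  heavy-0 (suc n) = cong (λ h → h + p * h) (heavy-0 n)

  heavy-1 : ∀ n → 1 + heavy {p} 1 n ≡ suc p ^ n
  heavy-1 zero    = refl
  heavy-1 (suc n) = cong₂ (λ h h' → h + p * h') (heavy-1 n) (heavy-0 n)

  -- The summands count the vectors with no mark, with exactly one, and with at least two.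
  heavy-2 : ∀ n → 1 + (p * n + heavy {p} 2 n) ≡ suc p ^ n
  heavy-2 zero    = cong (λ k → 1 + (k + 0)) (ℕₚ.*-zeroʳ p)
  heavy-2 (suc n) = trans (rearrange p n (heavy 2 n) (heavy 1 n))
      (cong₂ (λ h h' → h + p * h') (heavy-2 n) (heavy-1 n))
    where
    rearrange : ∀ p n a b → 1 + (p * suc n + (a + p * b)) ≡ 1 + (p * n + a) + p * (1 + b)
    rearrange = solveℕ-∀

  heavyℤ-1 : ∀ n → (+ suc p) ℤ.^ n ≡ + 1 ℤ.+ + heavy {p} 1 n
  heavyℤ-1 n = trans (sym (pos-^ (suc p) n)) (cong +_ (sym (heavy-1 n)))

  heavyℤ-2 : ∀ n → (+ suc p) ℤ.^ n ≡ + 1 ℤ.+ (+ p ℤ.* + n ℤ.+ + heavy {p} 2 n)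
  heavyℤ-2 n = trans (sym (pos-^ (suc p) n)) (trans (cong +_ (sym (heavy-2 n)))
    (cong (λ z → + 1 ℤ.+ (z ℤ.+ + heavy {p} 2 n)) (ℤₚ.pos-* p n)))

  -- `f` lists the tables with a single mark separately, as `p * r * s`, while `collinear` has them
  -- among the rows; moving this summand accounts for the difference between the two expressions.
  collinearℤ : ∀ r s → + collinear {p} r s ≡ f q r s
  collinearℤ r s = trans
    (cong₂ (λ a b → + 1 ℤ.+ (a ℤ.+ b)) (ℤₚ.pos-* r (heavy 1 s)) (ℤₚ.pos-* s (heavy 2 r)))
    (trans (expand (+ p) (+ r) (+ s) (+ heavy {p} 1 s) (+ heavy {p} 2 r))
      (cong₂ (λ x y → + 1 ℤ.+ + p ℤ.* + r ℤ.* + s ℤ.+ + r ℤ.* (x ℤ.- + p ℤ.* + s ℤ.- + 1) ℤ.+ + s ℤ.*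
          (y ℤ.- + p ℤ.* + r ℤ.- + 1))
        (sym (heavyℤ-1 s)) (sym (heavyℤ-2 r))))
    where
    expand : ∀ P R S a b → + 1 ℤ.+ (R ℤ.* a ℤ.+ S ℤ.* b) ≡
      + 1 ℤ.+ P ℤ.* R ℤ.* S ℤ.+ R ℤ.* ((+ 1 ℤ.+ a) ℤ.- P ℤ.* S ℤ.- + 1)
        ℤ.+ S ℤ.* ((+ 1 ℤ.+ (P ℤ.* R ℤ.+ b)) ℤ.- P ℤ.* R ℤ.- + 1)
    expand = solve-∀

  cornerCountℤ : ∀ r s → + cornerCount p r s ≡ cornerℤ r s
  cornerCountℤ zero    s       = refl
  cornerCountℤ (suc r) zero    = refl
  cornerCountℤ (suc r) (suc s) = collinearℤ (suc r) (suc s)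

  all-positive : ∀ n → + (1 + n * p) ≡ + 1 ℤ.+ + p ℤ.* + n
  all-positive n = cong (λ z → + 1 ℤ.+ z) (trans (ℤₚ.pos-* n p) (ℤₚ.*-comm (+ n) (+ p)))

  -- Exactly one of the two summands is nonzero: the empty composition for m = 0 and the one-part
  -- composition for m > 0.
  base : ∀ {N} m → m ≤ N → + (1 + m * p) ≡ compositions N body 0 m ℤ.+ compositions N body 1 m
  base {N} m m≤N = trans (all-positive m)
      (sym (trans (cong₂ ℤ._+_ (compositions-0 N body m) (compositions-1 m≤N)) (merge m)))
    where
    merge : ∀ m → guard (0 ℕ.≟ m) (+ 1) ℤ.+ ifPositive m (+ 1 ℤ.+ + p ℤ.* + m) ≡ + 1 ℤ.+ + p ℤ.* + m
    merge zero    = cong (λ z → + 1 ℤ.+ z) (sym (ℤₚ.*-zeroʳ (+ p)))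
    merge (suc m) = ℤₚ.+-identityˡ _

  -- Each border consumes two entries of a composition, so lengths 0 and 1 match the positive
  -- matrices and length j + 2 matches a border around length j.
  coreCount-compositions : ∀ {N} J {m} → m ≤ J → m ≤ N → + coreCount p N J m ≡ sumTo
      (λ j → compositions N body j m) J
  coreCount-compositions {N} zero {zero} _ m≤N = sym (compositions-0 N body 0)
  coreCount-compositions {N} (suc zero) {m} _ m≤N = base m m≤N
  coreCount-compositions {N} (suc (suc J)) {m} m≤J m≤N =
    trans (cong₂ ℤ._+_ (base m m≤N) step)
      (ℤₚ.+-assoc (compositions N body 0 m) (compositions N body 1 m) _)
    where
    corners : ∀ r s k → r + (s + k) ≡ m →
      + (cornerCount p r s * coreCount p N J k) ≡ sumTo (λ j → cornerℤ r s ℤ.* compositions N body j k) J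
    corners zero    s       k eq = sym (sumTo-* (+ 0) (λ j → compositions N body j k) J)
    corners (suc r) zero    k eq = sym (sumTo-* (+ 0) (λ j → compositions N body j k) J)
    corners (suc r) (suc s) k eq = trans (ℤₚ.pos-* (cornerCount p (suc r) (suc s)) _)
      (trans (cong₂ ℤ._*_ (cornerCountℤ (suc r) (suc s)) (coreCount-compositions J k≤J (ℕₚ.≤-trans k≤m m≤N)))
        (sym (sumTo-* (cornerℤ (suc r) (suc s)) _ J)))
      where
      size : suc (suc (r + (s + k))) ≡ m
      size = trans (cong suc (sym (ℕₚ.+-suc r (s + k)))) eq
      k≤ : k ≤ r + (s + k)
      k≤ = ℕₚ.≤-trans (ℕₚ.m≤n+m k s) (ℕₚ.m≤n+m (s + k) r)
      k≤J : k ≤ J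
      k≤J = ℕₚ.≤-trans k≤ (ℕₚ.≤-pred (ℕₚ.≤-pred (ℕₚ.≤-trans (ℕₚ.≤-reflexive size) m≤J)))
      k≤m : k ≤ m
      k≤m = ℕₚ.≤-trans k≤ (ℕₚ.≤-trans (ℕₚ.m≤n+m _ 2) (ℕₚ.≤-reflexive size))
    step : + splittings N m (λ r m' → splittings N m' λ s k → cornerCount p r s * coreCount p N J k)
      ≡ sumTo (λ j → compositions N body (suc (suc j)) m) J
    step = trans (splittingsℤ-pos N m λ r m' → splittings N m' λ s k → cornerCount p r s * coreCount p N J k)
        (trans
      (splittingsℤ-cong N m λ r m' r+m' → trans
          (splittingsℤ-pos N m' λ s k → cornerCount p r s * coreCount p N J k) (trans
        (splittingsℤ-cong N m' λ s k s+k → corners r s k (trans (cong (λ k → r + k) s+k) r+m'))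
        (sym (splittingsℤ-sumTo N m' J λ j s k → cornerℤ r s ℤ.* compositions N body j k))))
      (trans (sym (splittingsℤ-sumTo N m J λ j r m' → splittingsℤ N m' λ s k →
          cornerℤ r s ℤ.* compositions N body j k))
        (sumTo-cong (λ j → sym (compositions-suc-suc N j m)) J)))

  -- Terms of the formula

  pairs : List ℕ → ℕ → ℤ
  pairs ns h = prodℤ (applyUpTo (λ i → f q (at ns (2 * i)) (at ns (suc (2 * i)))) h)

  pairs-product : ∀ x ns h →
    prodℤ (map (λ i → f q (at (x ∷ ns) (2 * i ∸ 1)) (at (x ∷ ns) (2 * i))) (map suc (upTo h))) ≡ pairs ns h
  pairs-product x ns h = cong prodℤ (trans (sym (Listₚ.map-∘ (upTo h))) (trans (Listₚ.map-applyUpTo id _ h)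
    (applyUpTo-cong (λ i → cong (λ k → f q (at (x ∷ ns) (k ∸ 1)) (at (x ∷ ns) k)) (double-suc i)) h)))

  -- The last factor of the formula after n₀ has cancelled from n and from the partial sum.
  leftover : List ℕ → ℕ → ℤ
  leftover ns h = + 1 ℤ.+ + p ℤ.* (+ sum ns ℤ.- + sum (take (2 * h) ns))

  body-eq : ∀ ns → pairs ns (length ns / 2) ℤ.* leftover ns (length ns / 2) ≡ body ns
  body-eq []       = trans (ℤₚ.*-identityˡ _) (cong (λ z → + 1 ℤ.+ z) (ℤₚ.*-zeroʳ (+ p)))
  body-eq (x ∷ []) = trans (ℤₚ.*-identityˡ _)
      (cong (λ z → + 1 ℤ.+ + p ℤ.* z) (trans (ℤₚ.+-identityʳ _) (cong +_ (ℕₚ.+-identityʳ x))))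
  body-eq (r ∷ s ∷ ns) rewrite half-suc-suc (length ns) =
    trans (cong₂ (λ a b → f q r s ℤ.* a ℤ.* b) shift-pairs shift-leftover)
      (trans (ℤₚ.*-assoc (f q r s) _ _) (cong (f q r s ℤ.*_) (body-eq ns)))
    where
    h = length ns / 2
    shift-pairs : prodℤ (applyUpTo
        (λ i → f q (at (r ∷ s ∷ ns) (2 * suc i)) (at (r ∷ s ∷ ns) (suc (2 * suc i)))) h) ≡ pairs ns h
    shift-pairs = cong prodℤ (applyUpTo-cong
        (λ i → cong (λ k → f q (at (r ∷ s ∷ ns) k) (at (r ∷ s ∷ ns) (suc k))) (double-suc i)) h)
    shift-leftover : leftover (r ∷ s ∷ ns) (suc h) ≡ leftover ns h
    shift-leftover = cong (λ z → + 1 ℤ.+ + p ℤ.* z) (trans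
      (cong (λ k → + (r + (s + sum ns)) ℤ.- + sum (take k (r ∷ s ∷ ns))) (double-suc h))
      (cancel (+ r) (+ s) (+ sum ns) (+ sum (take (2 * h) ns))))
      where
      cancel : ∀ a b c d → (a ℤ.+ (b ℤ.+ c)) ℤ.- (a ℤ.+ (b ℤ.+ d)) ≡ c ℤ.- d
      cancel = solve-∀

  term-eq : ∀ {n} j x ns → length ns ≡ j → x + sum ns ≡ n → term q n j (x ∷ ns) ≡ + multinomial
      (x ∷ ns) ℤ.* body ns
  term-eq _ x ns refl refl =
      trans (ℤₚ.*-assoc (+ multinomial (x ∷ ns)) _ _) (cong (+ multinomial (x ∷ ns) ℤ.*_)
    (trans (cong₂ ℤ._*_ (pairs-product x ns (length ns / 2)) (cong (λ z → + 1 ℤ.+ + p ℤ.* z)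
      (cancel (+ x) (+ sum ns) (+ sum (take (2 * (length ns / 2)) ns))))) (body-eq ns)))
    where
    cancel : ∀ a b c → (a ℤ.+ b) ℤ.- (a ℤ.+ c) ≡ b ℤ.- c
    cancel = solve-∀

  level : ℕ → ℕ → ℤ
  level n j = splittingsℤ n n (λ _ k → compositions n body j k)

  sum-terms : ∀ n j → sumℤ (map (term q n j) (S n j)) ≡ level n j
  sum-terms n j = trans (∑ℤ-filter _ (term q n j) (tuples (suc j) n)) (trans (∑ℤ-tuples j n _)
    (∑ℤ-cong (λ x → trans
        (∑ℤ-tuples-cong j n λ ns len → trans
          (guard-cong ((x + sum ns ℕ.≟ n) ×-dec positive? ns) λ (eq , _) → term-eq j x ns len eq)
          (peel (positive? ns) n x ns (body ns)))
        (∑ℤ-* (+ (n C x)) _ (tuples j n)))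
      (upTo (suc n))))

  -- Only n₀ = n survives, which is the zero matrix and the leading 1 of the formula.
  level-0 : ∀ n → level n 0 ≡ + 1
  level-0 n = trans (splittingsℤ-cong n n λ _ k _ → compositions-0 n body k)
      (splittingsℤ-all {n} {n} ℕₚ.≤-refl λ _ → + 1)

  formula-eq : ∀ n → + splittings n n (λ _ k → coreCount p n n k) ≡ formula q n
  formula-eq n = trans (splittingsℤ-pos n n λ _ k → coreCount p n n k) (trans
    (splittingsℤ-cong n n λ a k eq → coreCount-compositions n (k≤n a k eq) (k≤n a k eq))
    (trans (sym (splittingsℤ-sumTo n n n λ j _ k → compositions n body j k))
    (trans (sym (sumℤ-applyUpTo (level n) n))
    (cong₂ ℤ._+_ (level-0 n) (cong sumℤ
        (sym (trans (sym (Listₚ.map-∘ (upTo n))) (trans (Listₚ.map-applyUpTo id _ n)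
      (applyUpTo-cong (λ j → sum-terms n (suc j)) n)))))))))
    where
    k≤n : ∀ a k → a + k ≡ n → k ≤ n
    k≤n a k eq = ℕₚ.≤-trans (ℕₚ.m≤n+m k a) (ℕₚ.≤-reflexive eq)

theorem3p7 : (q n : ℕ) → 2 ≤ q → 1 ≤ n →
    Σ ℕ (λ k → CountIs (λ (M : Matrix q n) → IsSymmetric M × IsLonesum M) k
    × (+ k ≡ formula q n))
theorem3p7 (suc (suc p)) n _ _ = _ , count-symmetric-lonesum n , formula-eq p n
theorem3p7 (suc zero)    _ (s≤s ()) _
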